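{- For every integer $m\ge 1$, \[ \sum_{n=1}^{\infty} a^+_m(n)\, q^n =(-1)^{m}+ \frac{(-1)^{m-1}}{(q;q)_{\infty}} \sum_{l=0}^{m-1}(-1)^{l} q^{\frac{l(3l+1)}{2}}(1-q^{2l+1}) \] and \[ \sum_{n=1}^{\infty} a^-_m(n)\, q^n =(-1)^{m}+ \frac{(-1)^{m-1}}{(q;q)_{\infty}} \sum_{l=0}^{m-1}(-1)^l q^{\frac{l(3l-1)}{2}}(1-q^{4l+2}). \]
   Context: Every partition $\lambda$ of $n$ has a Frobenius symbol $\begin{pmatrix} x_1 & \cdots & x_d\\ y_1&\cdots & y_d\end{pmatrix}$, where $d$ is the number of dots on the main diagonal of the Ferrers graph, $x_i$ (resp. $y_i$) is the number of dots in row $i$ to the right of the diagonal (resp. in column $i$ below the diagonal); so $x_1>\cdots>x_d\ge 0$, $y_1>\cdots>y_d\ge0$, $\sum_i (x_i+y_i+1)=n$. Column $i$ is positive if $x_i-y_i\ge1$ and negative if $x_i-y_i\le 0$. Parity blocks are maximal sets of contiguous columns all of the same sign; a block is positive/negative according to its columns' sign. For $m\ge 1$, $a^+_m(n)$ (resp. $a^-_m(n)$) is the number of partitions of $n$ whose Frobenius symbol has exactly $m$ parity blocks with the last (rightmost) block positive (resp. negative). $(a;q)_\infty=\prod_{k\ge0}(1-aq^k)$, $|q|<1$. -}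

module Defs where

open import Data.Bool using (Bool; true; false; if_then_else_; _∧_; not)
open import Data.Nat as ℕ using (ℕ; zero; suc; _∸_; _≡ᵇ_; _≤ᵇ_; _<ᵇ_)
open import Data.Nat.DivMod using (_/_)
open import Data.Integer as ℤ using (ℤ; +_; -[1+_]; -_; _^_)
open import Data.List using (List; []; _∷_; map; concatMap; filter; length; sum; foldr; applyUpTo; upTo; zip)
open import Relation.Nullary.Decidable using (yes; no)
open import Data.Bool using (T)
open import Data.Bool.Properties using (T?)

-- Integer partitions, enumerated explicitly.
-- A partition is a weakly decreasing list of positive parts.

range1 : ℕ → List ℕ
range1 k = applyUpTo suc k

-- partitionsAux fuel n k : all partitions of n with every part ≤ k
-- (correct whenever n ≤ fuel)
partitionsAux : ℕ → ℕ → ℕ → List (List ℕ)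
partitionsAux zero    zero    k = [] ∷ []
partitionsAux zero    (suc n) k = []
partitionsAux (suc f) zero    k = [] ∷ []
partitionsAux (suc f) (suc n) k =
  concatMap (λ j → map (j ∷_) (partitionsAux f (suc n ∸ j) j))
            (range1 (ℕ._⊓_ k (suc n)))

partitions : ℕ → List (List ℕ)
partitions n = partitionsAux n n n

-- i-th part (1-indexed), 0 beyond the length
part : List ℕ → ℕ → ℕ
part []       _             = 0
part (x ∷ xs) zero          = 0
part (x ∷ xs) (suc zero)    = x
part (x ∷ xs) (suc (suc i)) = part xs (suc i)

conjPart : List ℕ → ℕ → ℕ
conjPart λs i = length (filter (λ x → T? (i ≤ᵇ x)) λs)

diagonal : List ℕ → ℕ
diagonal λs = length (filter (λ i → T? (i ≤ᵇ part λs i)) (range1 (length λs)))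

-- Frobenius symbol as the list of columns (x_i , y_i), i = 1..d:
-- x_i = dots in row i right of the diagonal, y_i = dots in column i below it.
record Column : Set where
  constructor col
  field
    xc : ℕ
    yc : ℕ

frobenius : List ℕ → List Column
frobenius λs = map (λ i → col (part λs i ∸ i) (conjPart λs i ∸ i)) (range1 (diagonal λs))

-- column sign: true = positive (x - y ≥ 1), false = negative (x - y ≤ 0)
positive : Column → Bool
positive (col x y) = suc y ≤ᵇ x

-- Parity blocks: maximal runs of equal sign.  'runs' collapses each run
-- to a single sign, so its length is the number of blocks and its last
-- element is the sign of the last block.

runs : List Bool → List Bool
runs []           = []
runs (b ∷ [])     = b ∷ []
runs (b ∷ c ∷ bs) with runs (c ∷ bs)
... | r = if eqb b c then r else b ∷ r
  where
  eqb : Bool → Bool → Bool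
  eqb true  true  = true
  eqb false false = true
  eqb _     _     = false

lastSign : List Bool → Bool → Bool
lastSign []       d = d
lastSign (b ∷ bs) d = lastSign bs b

blockSigns : List ℕ → List Bool
blockSigns λs = runs (map positive (frobenius λs))

hasBlocks : ℕ → Bool → List ℕ → Bool
hasBlocks m s λs with blockSigns λs
... | [] = false
... | b ∷ bs = (length (b ∷ bs) ≡ᵇ m) ∧ eqB (lastSign bs b) s
  where
  eqB : Bool → Bool → Bool
  eqB true  true  = true
  eqB false false = true
  eqB _     _     = false

aPlus : ℕ → ℕ → ℕ
aPlus m n = length (filter (λ λs → T? (hasBlocks m true λs)) (partitions n))

aMinus : ℕ → ℕ → ℕ
aMinus m n = length (filter (λ λs → T? (hasBlocks m false λs)) (partitions n))

-- Formal power series over ℤ, given by coefficients.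

PS : Set
PS = ℕ → ℤ

sumTo : ℕ → (ℕ → ℤ) → ℤ
sumTo zero    f = f 0
sumTo (suc n) f = sumTo n f ℤ.+ f (suc n)

sumBelow : ℕ → (ℕ → ℤ) → ℤ
sumBelow zero    f = + 0
sumBelow (suc n) f = sumBelow n f ℤ.+ f n

_*ₚ_ : PS → PS → PS
(f *ₚ g) n = sumTo n (λ k → f k ℤ.* g (n ∸ k))

_+ₚ_ : PS → PS → PS
(f +ₚ g) n = f n ℤ.+ g n

constₚ : ℤ → PS
constₚ c zero    = c
constₚ c (suc n) = + 0

monoₚ : ℕ → PS
monoₚ e n = if e ≡ᵇ n then + 1 else + 0

qqUpTo : ℕ → PS
qqUpTo zero    = constₚ (+ 1)
qqUpTo (suc N) = qqUpTo N *ₚ (constₚ (+ 1) +ₚ (λ n → - monoₚ (suc N) n))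

-- (q;q)_∞ = ∏_{k≥1}(1-q^k); its q^n coefficient equals that of the
-- finite product up to k = n.
qqInf : PS
qqInf n = qqUpTo n n

-- reciprocal of a power series with constant term 1:
-- b_0 = 1, b_n = - Σ_{k=1}^{n} f_k b_{n-k}.
nth : List ℤ → ℕ → ℤ
nth []       _       = + 0
nth (x ∷ xs) zero    = x
nth (x ∷ xs) (suc i) = nth xs i

snoc : List ℤ → ℤ → List ℤ
snoc []       y = y ∷ []
snoc (x ∷ xs) y = x ∷ snoc xs y

recipList : PS → ℕ → List ℤ
recipList f zero    = + 1 ∷ []
recipList f (suc n) =
  let v = recipList f n in
  snoc v (- sumTo n (λ k → f (suc k) ℤ.* nth v (n ∸ k)))

recipₚ : PS → PS
recipₚ f n = nth (recipList f n) n

sgn : ℕ → ℤ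
sgn k = -[1+ 0 ] ^ k

scaleₚ : ℤ → PS → PS
scaleₚ c f n = c ℤ.* f n

genSeries : (ℕ → ℕ) → PS
genSeries a zero    = + 0
genSeries a (suc n) = + a (suc n)

sumPlus : ℕ → PS
sumPlus m n = sumBelow m (λ l →
  sgn l ℤ.* (monoₚ (l ℕ.* (3 ℕ.* l ℕ.+ 1) / 2) n
             ℤ.- monoₚ (l ℕ.* (3 ℕ.* l ℕ.+ 1) / 2 ℕ.+ (2 ℕ.* l ℕ.+ 1)) n))

sumMinus : ℕ → PS
sumMinus m n = sumBelow m (λ l →
  sgn l ℤ.* (monoₚ (l ℕ.* (3 ℕ.* l ∸ 1) / 2) n
             ℤ.- monoₚ (l ℕ.* (3 ℕ.* l ∸ 1) / 2 ℕ.+ (4 ℕ.* l ℕ.+ 2)) n))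

rhs : ℕ → PS → PS
rhs m S = constₚ (sgn m) +ₚ scaleₚ (sgn (m ∸ 1)) (recipₚ qqInf *ₚ S)

{-# OPTIONS --safe #-}

-- Let c(f, m) be the series counting partitions whose sequence of column signs has an alternating
-- subsequence of length m starting with f. Partitions with m blocks starting with f, together with
-- those with m + 1 blocks starting with ¬ f, are counted by c(f, m) − c(f, m + 1), so the theorem
-- follows by telescoping once c(f, m) = q^e / (q;q)_∞ with e = energy f m a pentagonal number.
--
-- To compute c(f, m), restrict to partitions in an a × b box. Removing the outermost hook, that is the
-- first Frobenius column, gives the recurrence altSum-suc. If a ≥ b (for f negative) or a ≤ b + 1
-- (for f positive), the count is q^e times a Gaussian binomial: inside the region this is the
-- recurrence of the full box count, and at its boundary the first letter is consumed, which ties the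
-- value to that of the shorter sequence starting with ¬ f. Letting the box grow, the Gaussian binomial
-- becomes 1 / (q;q)_∞.

module Submission where

-- The box is there to fix a sign: a partition that touches both far sides of a box has a first
-- column given by the sides, so inclusion-exclusion over boxes knows the letter it adds. If that
-- letter is not the one awaited, the word stays the same and the recurrence is closed; otherwise
-- the word gets shorter. Hence a closed formula can be expected only on one side of the diagonal.
-- In the recurrence of `[a+b, k]` the hook exponent depends on `a + b` alone, so every displaced
-- term `q^e [a+b, a+h]` solves it as well. The freedom in `e` and `h` serves to meet the condition
-- on the boundary line, as in a reflection principle. A column with `x = y` is negative, so the
-- boundary lines for the two letters are `a = b` and `a = b + 1`; reflecting in them moves the
-- index by 1 and by 2 in turn. So `h` grows linearly and `e` quadratically, which is where the
-- pentagonal numbers come from. The two regions overlap in `b ≤ a ≤ b + 1`, just enough to pass a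
-- formula from one letter to the other. In the telescoping the last sign is held fixed, so the
-- first sign alternates with the number of blocks.

open import Defs
open import Data.Bool using (Bool; true; false; if_then_else_; not; T; _∧_)
open import Data.Bool.Properties using (T?; not-involutive)
open import Data.Integer as ℤ using (ℤ; +_; -_)
import Data.Integer.Properties as ℤ
open import Data.Integer.Tactic.RingSolver using (solve-∀)
open import Data.List using (List; []; _∷_; map; concatMap; filter; length; applyUpTo; _++_; _∷ʳ_)
open import Data.List.Properties using (applyUpTo-∷ʳ; map-applyUpTo; concatMap-++)
open import Data.List.Relation.Unary.All as All using (All; []; _∷_)
open import Data.Nat using (ℕ; zero; suc; _+_; _*_; _∸_; _⊓_; _≤_; _<_; z≤n; s≤s; s≤s⁻¹; _≡ᵇ_; _<ᵇ_; _≤ᵇ_; _≤?_)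
open import Data.Nat.DivMod using (_/_; m*n/n≡m)
open import Data.Nat.Properties
import Data.Nat.Tactic.RingSolver as ℕ-Solver
open import Data.Product using (_×_; _,_; proj₂; ∃₂)
open import Data.Sum using (inj₁; inj₂)
open import Function using (_∘_)
open import Relation.Binary.PropositionalEquality
open import Relation.Nullary using (yes; no)

-- Formal power series

-- Multiplication by `q^e`, by recursion on `e` instead of subtraction in the index.
shift : ℕ → PS → PS
shift zero    f n       = f n
shift (suc e) f zero    = + 0
shift (suc e) f (suc n) = shift e f n

shift-cong : ∀ e {f g} → f ≗ g → shift e f ≗ shift e g
shift-cong zero    p n       = p n
shift-cong (suc e) p zero    = refl
shift-cong (suc e) p (suc n) = shift-cong e p n

shift-shift : ∀ a b f → shift a (shift b f) ≗ shift (a + b) f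
shift-shift zero    b f n       = refl
shift-shift (suc a) b f zero    = refl
shift-shift (suc a) b f (suc n) = shift-shift a b f n

shift-comm : ∀ a b f → shift a (shift b f) ≗ shift b (shift a f)
shift-comm a b f n = begin
  shift a (shift b f) n ≡⟨ shift-shift a b f n ⟩
  shift (a + b) f n     ≡⟨ cong (λ e → shift e f n) (+-comm a b) ⟩
  shift (b + a) f n     ≡⟨ shift-shift b a f n ⟨
  shift b (shift a f) n ∎
  where open ≡-Reasoning

shift-+ : ∀ e f g n → shift e (λ i → f i ℤ.+ g i) n ≡ shift e f n ℤ.+ shift e g n
shift-+ zero    f g n       = refl
shift-+ (suc e) f g zero    = refl
shift-+ (suc e) f g (suc n) = shift-+ e f g n

shift-- : ∀ e f g n → shift e (λ i → f i ℤ.- g i) n ≡ shift e f n ℤ.- shift e g n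
shift-- zero    f g n       = refl
shift-- (suc e) f g zero    = refl
shift-- (suc e) f g (suc n) = shift-- e f g n

shift-0 : ∀ e n → shift e (λ _ → + 0) n ≡ + 0
shift-0 zero    n       = refl
shift-0 (suc e) zero    = refl
shift-0 (suc e) (suc n) = shift-0 e n

shift-≤ : ∀ e f {n} → e ≤ n → shift e f n ≡ f (n ∸ e)
shift-≤ zero    f z≤n     = refl
shift-≤ (suc e) f (s≤s p) = shift-≤ e f p

shift-< : ∀ e f {n} → n < e → shift e f n ≡ + 0
shift-< (suc e) f {zero}  p       = refl
shift-< (suc e) f {suc n} (s≤s p) = shift-< e f p

shift-cong-≤ : ∀ e {f g} n → (∀ {j} → j ≤ n → f j ≡ g j) → shift e f n ≡ shift e g n
shift-cong-≤ zero    n       p = p ≤-refl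
shift-cong-≤ (suc e) zero    p = refl
shift-cong-≤ (suc e) (suc n) p = shift-cong-≤ e n (λ j≤n → p (m≤n⇒m≤1+n j≤n))

shift-cancel : ∀ e {f g} → shift e f ≗ shift e g → f ≗ g
shift-cancel zero    p n = p n
shift-cancel (suc e) p n = shift-cancel e (λ i → p (suc i)) n

sumTo-cong : ∀ n {f g} → (∀ k → k ≤ n → f k ≡ g k) → sumTo n f ≡ sumTo n g
sumTo-cong zero    p = p 0 z≤n
sumTo-cong (suc n) p = cong₂ ℤ._+_ (sumTo-cong n (λ k k≤n → p k (m≤n⇒m≤1+n k≤n))) (p (suc n) ≤-refl)

sumTo-suc : ∀ n f → sumTo (suc n) f ≡ f 0 ℤ.+ sumTo n (f ∘ suc)
sumTo-suc zero    f = refl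
sumTo-suc (suc n) f = trans (cong (ℤ._+ f (2 + n)) (sumTo-suc n f)) (ℤ.+-assoc (f 0) _ _)

+-interchange : ∀ a b c d → (a ℤ.+ b) ℤ.+ (c ℤ.+ d) ≡ (a ℤ.+ c) ℤ.+ (b ℤ.+ d)
+-interchange = solve-∀

sumTo-+ : ∀ n f g → sumTo n (λ k → f k ℤ.+ g k) ≡ sumTo n f ℤ.+ sumTo n g
sumTo-+ zero    f g = refl
sumTo-+ (suc n) f g = trans (cong (ℤ._+ (f (suc n) ℤ.+ g (suc n))) (sumTo-+ n f g)) (+-interchange (sumTo n f) (sumTo n g) (f (suc n)) (g (suc n)))

sumTo-* : ∀ n c f → sumTo n (λ k → c ℤ.* f k) ≡ c ℤ.* sumTo n f
sumTo-* zero    c f = refl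
sumTo-* (suc n) c f =
  trans (cong (ℤ._+ c ℤ.* f (suc n)) (sumTo-* n c f)) (sym (ℤ.*-distribˡ-+ c (sumTo n f) (f (suc n))))

sumTo-0 : ∀ n {f} → (∀ k → f k ≡ + 0) → sumTo n f ≡ + 0
sumTo-0 zero    p = p 0
sumTo-0 (suc n) p = cong₂ ℤ._+_ (sumTo-0 n p) (p (suc n))

*ₚ-congʳ : ∀ f {g h} → g ≗ h → f *ₚ g ≗ f *ₚ h
*ₚ-congʳ f p n = sumTo-cong n (λ k _ → cong (f k ℤ.*_) (p (n ∸ k)))

*ₚ-congˡ : ∀ {f g} h → f ≗ g → f *ₚ h ≗ g *ₚ h
*ₚ-congˡ h p n = sumTo-cong n (λ k _ → cong (ℤ._* h (n ∸ k)) (p k))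

*ₚ-distribˡ-+ : ∀ f g h n → (f *ₚ (g +ₚ h)) n ≡ (f *ₚ g) n ℤ.+ (f *ₚ h) n
*ₚ-distribˡ-+ f g h n =
  trans (sumTo-cong n (λ k _ → ℤ.*-distribˡ-+ (f k) (g (n ∸ k)) (h (n ∸ k)))) (sumTo-+ n _ _)

*ₚ-distribʳ-- : ∀ f g h n → ((λ i → g i ℤ.- h i) *ₚ f) n ≡ (g *ₚ f) n ℤ.- (h *ₚ f) n
*ₚ-distribʳ-- f g h n = begin
  sumTo n (λ k → (g k ℤ.- h k) ℤ.* f (n ∸ k))
    ≡⟨ sumTo-cong n (λ k _ → expand (g k) (h k) (f (n ∸ k))) ⟩
  sumTo n (λ k → g k ℤ.* f (n ∸ k) ℤ.+ ℤ.-[1+ 0 ] ℤ.* (h k ℤ.* f (n ∸ k)))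
    ≡⟨ sumTo-+ n _ _ ⟩
  (g *ₚ f) n ℤ.+ sumTo n (λ k → ℤ.-[1+ 0 ] ℤ.* (h k ℤ.* f (n ∸ k)))
    ≡⟨ cong (ℤ._+_ ((g *ₚ f) n)) (trans (sumTo-* n (ℤ.-[1+ 0 ]) _) (ℤ.-1*i≡-i ((h *ₚ f) n))) ⟩
  (g *ₚ f) n ℤ.- (h *ₚ f) n ∎
  where
  open ≡-Reasoning
  expand : ∀ x y z → (x ℤ.- y) ℤ.* z ≡ x ℤ.* z ℤ.+ ℤ.-[1+ 0 ] ℤ.* (y ℤ.* z)
  expand = solve-∀

*ₚ-scaleʳ : ∀ c f g n → (f *ₚ scaleₚ c g) n ≡ c ℤ.* (f *ₚ g) n
*ₚ-scaleʳ c f g n = trans (sumTo-cong n (λ k _ → swap (f k) c (g (n ∸ k)))) (sumTo-* n c _)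
  where
  swap : ∀ x y z → x ℤ.* (y ℤ.* z) ≡ y ℤ.* (x ℤ.* z)
  swap = solve-∀

*ₚ-negʳ : ∀ f g n → (f *ₚ (-_ ∘ g)) n ≡ - (f *ₚ g) n
*ₚ-negʳ f g n = begin
  (f *ₚ (-_ ∘ g)) n                ≡⟨ *ₚ-congʳ f (λ i → sym (ℤ.-1*i≡-i (g i))) n ⟩
  (f *ₚ scaleₚ (ℤ.-[1+ 0 ]) g) n   ≡⟨ *ₚ-scaleʳ (ℤ.-[1+ 0 ]) f g n ⟩
  ℤ.-[1+ 0 ] ℤ.* (f *ₚ g) n        ≡⟨ ℤ.-1*i≡-i ((f *ₚ g) n) ⟩
  - (f *ₚ g) n                     ∎
  where open ≡-Reasoning

*ₚ-shift₁ʳ : ∀ f g → f *ₚ shift 1 g ≗ shift 1 (f *ₚ g)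
*ₚ-shift₁ʳ f g zero    = ℤ.*-zeroʳ (f 0)
*ₚ-shift₁ʳ f g (suc n) = begin
  sumTo n (λ k → f k ℤ.* shift 1 g (suc n ∸ k)) ℤ.+ f (suc n) ℤ.* shift 1 g (n ∸ n)
    ≡⟨ cong₂ ℤ._+_
         (sumTo-cong n (λ k k≤n → cong (λ i → f k ℤ.* shift 1 g i) (+-∸-assoc 1 k≤n)))
         (trans (cong (λ i → f (suc n) ℤ.* shift 1 g i) (n∸n≡0 n)) (ℤ.*-zeroʳ (f (suc n)))) ⟩
  (f *ₚ g) n ℤ.+ + 0 ≡⟨ ℤ.+-identityʳ _ ⟩
  (f *ₚ g) n         ∎
  where open ≡-Reasoning

*ₚ-shift₁ˡ : ∀ f g → shift 1 f *ₚ g ≗ shift 1 (f *ₚ g)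
*ₚ-shift₁ˡ f g zero    = ℤ.*-zeroˡ (g 0)
*ₚ-shift₁ˡ f g (suc n) = begin
  (shift 1 f *ₚ g) (suc n)                ≡⟨ sumTo-suc n _ ⟩
  + 0 ℤ.* g (suc n) ℤ.+ (f *ₚ g) n        ≡⟨ cong (ℤ._+ (f *ₚ g) n) (ℤ.*-zeroˡ (g (suc n))) ⟩
  + 0 ℤ.+ (f *ₚ g) n                      ≡⟨ ℤ.+-identityˡ _ ⟩
  (f *ₚ g) n                              ∎
  where open ≡-Reasoning

*ₚ-shiftʳ : ∀ e f g → f *ₚ shift e g ≗ shift e (f *ₚ g)
*ₚ-shiftʳ zero    f g n = refl
*ₚ-shiftʳ (suc e) f g n = begin
  (f *ₚ shift (suc e) g) n       ≡⟨ *ₚ-congʳ f (λ i → sym (shift-shift 1 e g i)) n ⟩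
  (f *ₚ shift 1 (shift e g)) n   ≡⟨ *ₚ-shift₁ʳ f (shift e g) n ⟩
  shift 1 (f *ₚ shift e g) n     ≡⟨ shift-cong 1 (*ₚ-shiftʳ e f g) n ⟩
  shift 1 (shift e (f *ₚ g)) n   ≡⟨ shift-shift 1 e _ n ⟩
  shift (suc e) (f *ₚ g) n       ∎
  where open ≡-Reasoning

*ₚ-shiftˡ : ∀ e f g → shift e f *ₚ g ≗ shift e (f *ₚ g)
*ₚ-shiftˡ zero    f g n = refl
*ₚ-shiftˡ (suc e) f g n = begin
  (shift (suc e) f *ₚ g) n       ≡⟨ *ₚ-congˡ g (λ i → sym (shift-shift 1 e f i)) n ⟩
  (shift 1 (shift e f) *ₚ g) n   ≡⟨ *ₚ-shift₁ˡ (shift e f) g n ⟩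
  shift 1 (shift e f *ₚ g) n     ≡⟨ shift-cong 1 (*ₚ-shiftˡ e f g) n ⟩
  shift 1 (shift e (f *ₚ g)) n   ≡⟨ shift-shift 1 e _ n ⟩
  shift (suc e) (f *ₚ g) n       ∎
  where open ≡-Reasoning

1ₚ : PS
1ₚ = constₚ (+ 1)

constₚ-0 : ∀ n → constₚ (+ 0) n ≡ + 0
constₚ-0 zero    = refl
constₚ-0 (suc n) = refl

*ₚ-identityʳ : ∀ f → f *ₚ 1ₚ ≗ f
*ₚ-identityʳ f zero    = ℤ.*-identityʳ (f 0)
*ₚ-identityʳ f (suc n) = begin
  sumTo n (λ k → f k ℤ.* 1ₚ (suc n ∸ k)) ℤ.+ f (suc n) ℤ.* 1ₚ (n ∸ n)
    ≡⟨ cong₂ ℤ._+_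
         (trans (sumTo-cong n (λ k k≤n → trans (cong (λ i → f k ℤ.* 1ₚ i) (+-∸-assoc 1 k≤n)) (ℤ.*-zeroʳ (f k))))
                (sumTo-0 n (λ _ → refl)))
         (trans (cong (λ i → f (suc n) ℤ.* 1ₚ i) (n∸n≡0 n)) (ℤ.*-identityʳ (f (suc n)))) ⟩
  + 0 ℤ.+ f (suc n) ≡⟨ ℤ.+-identityˡ _ ⟩
  f (suc n)         ∎
  where open ≡-Reasoning

monoₚ≗shift : ∀ e → monoₚ e ≗ shift e 1ₚ
monoₚ≗shift zero    zero    = refl
monoₚ≗shift zero    (suc n) = refl
monoₚ≗shift (suc e) zero    = refl
monoₚ≗shift (suc e) (suc n) = monoₚ≗shift e n

*ₚ-monoʳ : ∀ e f → f *ₚ monoₚ e ≗ shift e f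
*ₚ-monoʳ e f n = begin
  (f *ₚ monoₚ e) n       ≡⟨ *ₚ-congʳ f (monoₚ≗shift e) n ⟩
  (f *ₚ shift e 1ₚ) n    ≡⟨ *ₚ-shiftʳ e f 1ₚ n ⟩
  shift e (f *ₚ 1ₚ) n    ≡⟨ shift-cong e (*ₚ-identityʳ f) n ⟩
  shift e f n            ∎
  where open ≡-Reasoning

nth-snoc-< : ∀ xs y {i} → i < length xs → nth (snoc xs y) i ≡ nth xs i
nth-snoc-< (x ∷ xs) y {zero}  p       = refl
nth-snoc-< (x ∷ xs) y {suc i} (s≤s p) = nth-snoc-< xs y p

nth-snoc-length : ∀ xs y → nth (snoc xs y) (length xs) ≡ y
nth-snoc-length []       y = refl
nth-snoc-length (x ∷ xs) y = nth-snoc-length xs y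

length-snoc : ∀ xs y → length (snoc xs y) ≡ suc (length xs)
length-snoc []       y = refl
length-snoc (x ∷ xs) y = cong suc (length-snoc xs y)

length-recipList : ∀ f n → length (recipList f n) ≡ suc n
length-recipList f zero    = refl
length-recipList f (suc n) = trans (length-snoc (recipList f n) _) (cong suc (length-recipList f n))

nth-recipList : ∀ f n {i} → i ≤ n → nth (recipList f n) i ≡ recipₚ f i
nth-recipList f zero    z≤n = refl
nth-recipList f (suc n) {i} i≤1+n with m≤n⇒m<n∨m≡n i≤1+n
... | inj₂ refl = refl
... | inj₁ i<1+n =
  trans (nth-snoc-< (recipList f n) _ (subst (i <_) (sym (length-recipList f n)) i<1+n))
        (nth-recipList f n (s≤s⁻¹ i<1+n))

recipₚ-suc : ∀ f n → recipₚ f (suc n) ≡ - sumTo n (λ k → f (suc k) ℤ.* recipₚ f (n ∸ k))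
recipₚ-suc f n = begin
  nth (snoc v s) (suc n)      ≡⟨ cong (nth (snoc v s)) (sym (length-recipList f n)) ⟩
  nth (snoc v s) (length v)   ≡⟨ nth-snoc-length v s ⟩
  s ≡⟨ cong -_ (sumTo-cong n (λ k _ → cong (f (suc k) ℤ.*_) (nth-recipList f n (m∸n≤m n k)))) ⟩
  - sumTo n (λ k → f (suc k) ℤ.* recipₚ f (n ∸ k)) ∎
  where
  open ≡-Reasoning
  v = recipList f n
  s = - sumTo n (λ k → f (suc k) ℤ.* nth v (n ∸ k))

-- Since the constant term is 1, the equation for coefficient `n` of an inverse determines it from
-- the earlier ones, by the recursion that defines `recipₚ`.
recipₚ-unique : ∀ f g → f 0 ≡ + 1 → f *ₚ g ≗ 1ₚ → recipₚ f ≗ g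
recipₚ-unique f g f0≡1 fg≗1 n = below n n ≤-refl
  where
  open ≡-Reasoning
  -- The bound `N` makes the strong induction on `n` structural.
  below : ∀ N n → n ≤ N → recipₚ f n ≡ g n
  below N zero _ = begin
    + 1            ≡⟨ fg≗1 0 ⟨
    f 0 ℤ.* g 0    ≡⟨ cong (ℤ._* g 0) f0≡1 ⟩
    + 1 ℤ.* g 0    ≡⟨ ℤ.*-identityˡ (g 0) ⟩
    g 0            ∎
  below (suc N) (suc n) (s≤s n≤N) = begin
    recipₚ f (suc n)                                     ≡⟨ recipₚ-suc f n ⟩
    - sumTo n (λ k → f (suc k) ℤ.* recipₚ f (n ∸ k))
      ≡⟨ cong -_ (sumTo-cong n (λ k _ → cong (f (suc k) ℤ.*_) (below N (n ∸ k) (≤-trans (m∸n≤m n k) n≤N)))) ⟩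
    - s                                                  ≡⟨ solveFor (g (suc n)) s (trans (sym split) (fg≗1 (suc n))) ⟩
    g (suc n)                                            ∎
    where
    s = sumTo n (λ k → f (suc k) ℤ.* g (n ∸ k))
    split : (f *ₚ g) (suc n) ≡ g (suc n) ℤ.+ s
    split = trans (sumTo-suc n _) (cong (ℤ._+ s) (trans (cong (ℤ._* g (suc n)) f0≡1) (ℤ.*-identityˡ _)))
    rearrange : ∀ x y → - y ≡ x ℤ.- (x ℤ.+ y)
    rearrange = solve-∀
    solveFor : ∀ x y → x ℤ.+ y ≡ + 0 → - y ≡ x
    solveFor x y p = trans (rearrange x y) (trans (cong (λ z → x ℤ.- z) p) (ℤ.+-identityʳ x))

sumBelow-cong : ∀ n {f g} → (∀ k → k < n → f k ≡ g k) → sumBelow n f ≡ sumBelow n g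
sumBelow-cong zero    p = refl
sumBelow-cong (suc n) p = cong₂ ℤ._+_ (sumBelow-cong n (λ k k<n → p k (m≤n⇒m≤1+n k<n))) (p n ≤-refl)

-- Weighted sums over partitions

listSum : ∀ {A : Set} → (A → ℤ) → List A → ℤ
listSum Q []       = + 0
listSum Q (x ∷ xs) = Q x ℤ.+ listSum Q xs

listSum-++ : ∀ {A : Set} (Q : A → ℤ) xs ys → listSum Q (xs ++ ys) ≡ listSum Q xs ℤ.+ listSum Q ys
listSum-++ Q []       ys = sym (ℤ.+-identityˡ _)
listSum-++ Q (x ∷ xs) ys = trans (cong (ℤ._+_ (Q x)) (listSum-++ Q xs ys)) (sym (ℤ.+-assoc (Q x) _ _))

listSum-0 : ∀ {A : Set} (xs : List A) → listSum (λ _ → + 0) xs ≡ + 0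
listSum-0 []       = refl
listSum-0 (x ∷ xs) = trans (ℤ.+-identityˡ _) (listSum-0 xs)

listSum-map : ∀ {A B : Set} (Q : B → ℤ) (h : A → B) xs → listSum Q (map h xs) ≡ listSum (Q ∘ h) xs
listSum-map Q h []       = refl
listSum-map Q h (x ∷ xs) = cong (ℤ._+_ (Q (h x))) (listSum-map Q h xs)

listSum-concatMap : ∀ {A B : Set} (Q : B → ℤ) (g : A → List B) (h : ℕ → A) n →
  listSum Q (concatMap g (applyUpTo h n)) ≡ sumBelow n (λ j → listSum Q (g (h j)))
listSum-concatMap Q g h zero    = refl
listSum-concatMap Q g h (suc n) = begin
  listSum Q (concatMap g (applyUpTo h (suc n)))
    ≡⟨ cong (listSum Q ∘ concatMap g) (applyUpTo-∷ʳ h n) ⟨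
  listSum Q (concatMap g (applyUpTo h n ∷ʳ h n))
    ≡⟨ cong (listSum Q) (concatMap-++ g (applyUpTo h n) (h n ∷ [])) ⟩
  listSum Q (concatMap g (applyUpTo h n) ++ (g (h n) ++ []))
    ≡⟨ listSum-++ Q (concatMap g (applyUpTo h n)) _ ⟩
  listSum Q (concatMap g (applyUpTo h n)) ℤ.+ listSum Q (g (h n) ++ [])
    ≡⟨ cong₂ ℤ._+_ (listSum-concatMap Q g h n)
         (trans (listSum-++ Q (g (h n)) []) (ℤ.+-identityʳ _)) ⟩
  sumBelow (suc n) (λ j → listSum Q (g (h j))) ∎
  where open ≡-Reasoning

indicator : Bool → ℤ
indicator b = if b then + 1 else + 0

length-filter-T? : ∀ {A : Set} (p : A → Bool) xs → + length (filter (λ x → T? (p x)) xs) ≡ listSum (indicator ∘ p) xs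
length-filter-T? p []       = refl
length-filter-T? p (x ∷ xs) with p x
... | true  = cong (ℤ._+_ (+ 1)) (length-filter-T? p xs)
... | false = trans (length-filter-T? p xs) (sym (ℤ.+-identityˡ _))

listSum-partitionsAux-suc : ∀ Q f n k → listSum Q (partitionsAux (suc f) (suc n) k) ≡
  sumBelow (k ⊓ suc n) (λ j → listSum (Q ∘ (suc j ∷_)) (partitionsAux f (n ∸ j) (suc j)))
listSum-partitionsAux-suc Q f n k =
  trans (listSum-concatMap Q (λ j → map (j ∷_) (partitionsAux f (suc n ∸ j) j)) suc (k ⊓ suc n))
        (sumBelow-cong (k ⊓ suc n) (λ j _ → listSum-map Q (suc j ∷_) (partitionsAux f (n ∸ j) (suc j))))

-- One induction serves two purposes: surplus fuel is harmless, and weights need to agree only on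
-- lists with the length and part bounds of actual partitions.
listSum-partitionsAux-cong : ∀ f f' {Q Q' : List ℕ → ℤ} n k → n ≤ f → n ≤ f' →
  (∀ μ → length μ ≤ n → All (_≤ k) μ → Q μ ≡ Q' μ) →
  listSum Q (partitionsAux f n k) ≡ listSum Q' (partitionsAux f' n k)
listSum-partitionsAux-cong zero    zero     zero k _ _ p = cong (ℤ._+ + 0) (p [] z≤n [])
listSum-partitionsAux-cong zero    (suc f') zero k _ _ p = cong (ℤ._+ + 0) (p [] z≤n [])
listSum-partitionsAux-cong (suc f) zero     zero k _ _ p = cong (ℤ._+ + 0) (p [] z≤n [])
listSum-partitionsAux-cong (suc f) (suc f') zero k _ _ p = cong (ℤ._+ + 0) (p [] z≤n [])
listSum-partitionsAux-cong (suc f) (suc f') {Q} {Q'} (suc n) k (s≤s n≤f) (s≤s n≤f') p = begin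
  listSum Q (partitionsAux (suc f) (suc n) k) ≡⟨ listSum-partitionsAux-suc Q f n k ⟩
  sumBelow (k ⊓ suc n) (λ j → listSum (Q ∘ (suc j ∷_)) (partitionsAux f (n ∸ j) (suc j)))
    ≡⟨ sumBelow-cong (k ⊓ suc n) (λ j j<K → listSum-partitionsAux-cong f f' (n ∸ j) (suc j)
         (≤-trans (m∸n≤m n j) n≤f) (≤-trans (m∸n≤m n j) n≤f')
         (λ μ len all → let j<k = ≤-trans j<K (m⊓n≤m k (suc n)) in
           p (suc j ∷ μ) (s≤s (≤-trans len (m∸n≤m n j)))
             (j<k ∷ All.map (λ x≤j → ≤-trans x≤j j<k) all))) ⟩
  sumBelow (k ⊓ suc n) (λ j → listSum (Q' ∘ (suc j ∷_)) (partitionsAux f' (n ∸ j) (suc j)))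
    ≡⟨ listSum-partitionsAux-suc Q' f' n k ⟨
  listSum Q' (partitionsAux (suc f') (suc n) k) ∎
  where open ≡-Reasoning

Weight : Set
Weight = List ℕ → ℤ

partitionSum : ℕ → Weight → PS
partitionSum k Q n = listSum Q (partitionsAux n n k)

partitionSum-cong : ∀ k {Q Q' : Weight} n → (∀ μ → length μ ≤ n → All (_≤ k) μ → Q μ ≡ Q' μ) →
  partitionSum k Q n ≡ partitionSum k Q' n
partitionSum-cong k n = listSum-partitionsAux-cong n n n k ≤-refl ≤-refl

partitionSum-≗ : ∀ k {Q Q' : Weight} → Q ≗ Q' → partitionSum k Q ≗ partitionSum k Q'
partitionSum-≗ k p n = partitionSum-cong k n (λ μ _ _ → p μ)

partitionSum-+ : ∀ k Q R n → partitionSum k (λ μ → Q μ ℤ.+ R μ) n ≡ partitionSum k Q n ℤ.+ partitionSum k R n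
partitionSum-+ k Q R n = go (partitionsAux n n k)
  where
  go : ∀ xs → listSum (λ μ → Q μ ℤ.+ R μ) xs ≡ listSum Q xs ℤ.+ listSum R xs
  go []       = refl
  go (x ∷ xs) = trans (cong (ℤ._+_ (Q x ℤ.+ R x)) (go xs)) (+-interchange (Q x) (R x) (listSum Q xs) (listSum R xs))

partitionSum-0 : ∀ k n → partitionSum k (λ _ → + 0) n ≡ + 0
partitionSum-0 k n = listSum-0 (partitionsAux n n k)

-- Split by whether the largest part equals `suc k`; if it does, take it off and let the weight put
-- it back.
partitionSum-suc : ∀ k Q n →
  partitionSum (suc k) Q n ≡ partitionSum k Q n ℤ.+ shift (suc k) (partitionSum (suc k) (Q ∘ (suc k ∷_))) n
partitionSum-suc k Q zero    = sym (ℤ.+-identityʳ _)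
partitionSum-suc k Q (suc n) with k ≤? n
... | yes k≤n = begin
  partitionSum (suc k) Q (suc n)    ≡⟨ listSum-partitionsAux-suc Q n n (suc k) ⟩
  sumBelow (suc (k ⊓ n)) term       ≡⟨ cong (λ i → sumBelow (suc i) term) (m≤n⇒m⊓n≡m k≤n) ⟩
  sumBelow k term ℤ.+ term k
    ≡⟨ cong₂ ℤ._+_
         (trans (cong (λ i → sumBelow i term) (sym (m≤n⇒m⊓n≡m (m≤n⇒m≤1+n k≤n)))) (sym (listSum-partitionsAux-suc Q n n k)))
         (trans (listSum-partitionsAux-cong n (n ∸ k) (n ∸ k) (suc k) (m∸n≤m n k) ≤-refl (λ _ _ _ → refl))
                (sym (shift-≤ k (partitionSum (suc k) (Q ∘ (suc k ∷_))) k≤n))) ⟩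
  partitionSum k Q (suc n) ℤ.+ shift k (partitionSum (suc k) (Q ∘ (suc k ∷_))) n ∎
  where
  open ≡-Reasoning
  term = λ j → listSum (Q ∘ (suc j ∷_)) (partitionsAux n (n ∸ j) (suc j))
... | no k≰n = begin
  partitionSum (suc k) Q (suc n)    ≡⟨ listSum-partitionsAux-suc Q n n (suc k) ⟩
  sumBelow (suc (k ⊓ n)) term
    ≡⟨ cong (λ i → sumBelow i term)
         (trans (cong suc (m≥n⇒m⊓n≡n (<⇒≤ n<k))) (sym (m≥n⇒m⊓n≡n n<k))) ⟩
  sumBelow (k ⊓ suc n) term         ≡⟨ listSum-partitionsAux-suc Q n n k ⟨
  partitionSum k Q (suc n)          ≡⟨ ℤ.+-identityʳ _ ⟨
  partitionSum k Q (suc n) ℤ.+ + 0  ≡⟨ cong (λ z → partitionSum k Q (suc n) ℤ.+ z) (shift-< k _ n<k) ⟨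
  partitionSum k Q (suc n) ℤ.+ shift k (partitionSum (suc k) (Q ∘ (suc k ∷_))) n ∎
  where
  open ≡-Reasoning
  n<k = ≰⇒> k≰n
  term = λ j → listSum (Q ∘ (suc j ∷_)) (partitionsAux n (n ∸ j) (suc j))

partitionSum-zero : ∀ Q n → partitionSum 0 Q n ≡ constₚ (Q []) n
partitionSum-zero Q zero    = ℤ.+-identityʳ (Q [])
partitionSum-zero Q (suc n) = refl

partitionSum-stable : ∀ k Q {n} → n ≤ k → partitionSum k Q n ≡ partitionSum n Q n
partitionSum-stable zero    Q z≤n = refl
partitionSum-stable (suc k) Q {n} n≤1+k with m≤n⇒m<n∨m≡n n≤1+k
... | inj₂ refl  = refl
... | inj₁ n<1+k = begin
  partitionSum (suc k) Q n      ≡⟨ partitionSum-suc k Q n ⟩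
  partitionSum k Q n ℤ.+ shift (suc k) (partitionSum (suc k) (Q ∘ (suc k ∷_))) n
    ≡⟨ cong₂ ℤ._+_ (partitionSum-stable k Q (s≤s⁻¹ n<1+k)) (shift-< (suc k) _ n<1+k) ⟩
  partitionSum n Q n ℤ.+ + 0    ≡⟨ ℤ.+-identityʳ _ ⟩
  partitionSum n Q n            ∎
  where open ≡-Reasoning

partitionCount : PS
partitionCount n = partitionSum n (λ _ → + 1) n

qqUpTo-suc : ∀ N n → qqUpTo (suc N) n ≡ qqUpTo N n ℤ.- shift (suc N) (qqUpTo N) n
qqUpTo-suc N n = begin
  (U *ₚ (1ₚ +ₚ (λ i → - monoₚ (suc N) i))) n           ≡⟨ *ₚ-distribˡ-+ U 1ₚ (λ i → - monoₚ (suc N) i) n ⟩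
  (U *ₚ 1ₚ) n ℤ.+ (U *ₚ (λ i → - monoₚ (suc N) i)) n
    ≡⟨ cong₂ ℤ._+_ (*ₚ-identityʳ U n) (trans (*ₚ-negʳ U (monoₚ (suc N)) n) (cong -_ (*ₚ-monoʳ (suc N) U n))) ⟩
  U n ℤ.- shift (suc N) U n                            ∎
  where
  open ≡-Reasoning
  U = qqUpTo N

qqUpTo-stable : ∀ N {n} → n ≤ N → qqUpTo N n ≡ qqInf n
qqUpTo-stable zero    z≤n = refl
qqUpTo-stable (suc N) {n} n≤1+N with m≤n⇒m<n∨m≡n n≤1+N
... | inj₂ refl  = refl
... | inj₁ n<1+N = begin
  qqUpTo (suc N) n                               ≡⟨ qqUpTo-suc N n ⟩
  qqUpTo N n ℤ.- shift (suc N) (qqUpTo N) n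
    ≡⟨ cong₂ ℤ._-_ (qqUpTo-stable N (s≤s⁻¹ n<1+N)) (shift-< (suc N) _ n<1+N) ⟩
  qqInf n ℤ.- + 0                                ≡⟨ ℤ.+-identityʳ _ ⟩
  qqInf n                                        ∎
  where open ≡-Reasoning

-- Allowing the part `N + 1` gives `P' = P + q^(N+1) P'`, so the new factor `1 - q^(N+1)` turns `P'`
-- back into `P`, without a geometric series.
qqUpTo-inverse : ∀ N → qqUpTo N *ₚ partitionSum N (λ _ → + 1) ≗ 1ₚ
qqUpTo-inverse zero    n = trans (*ₚ-congʳ 1ₚ P₀≗1 n) (*ₚ-identityʳ 1ₚ n)
  where
  P₀≗1 : partitionSum 0 (λ _ → + 1) ≗ 1ₚ
  P₀≗1 = partitionSum-zero (λ _ → + 1)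
qqUpTo-inverse (suc N) n = begin
  (qqUpTo (suc N) *ₚ P') n                                ≡⟨ *ₚ-congˡ P' (qqUpTo-suc N) n ⟩
  ((λ i → U i ℤ.- shift (suc N) U i) *ₚ P') n             ≡⟨ *ₚ-distribʳ-- P' U (shift (suc N) U) n ⟩
  (U *ₚ P') n ℤ.- (shift (suc N) U *ₚ P') n
    ≡⟨ cong₂ (λ x y → x ℤ.- y)
         (trans (*ₚ-congʳ U (partitionSum-suc N (λ _ → + 1)) n) (*ₚ-distribˡ-+ U P (shift (suc N) P') n))
         (trans (*ₚ-shiftˡ (suc N) U P' n) (sym (*ₚ-shiftʳ (suc N) U P' n))) ⟩
  ((U *ₚ P) n ℤ.+ (U *ₚ shift (suc N) P') n) ℤ.- (U *ₚ shift (suc N) P') n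
    ≡⟨ cancel ((U *ₚ P) n) ((U *ₚ shift (suc N) P') n) ⟩
  (U *ₚ P) n                                              ≡⟨ qqUpTo-inverse N n ⟩
  1ₚ n                                                    ∎
  where
  open ≡-Reasoning
  U  = qqUpTo N
  P  = partitionSum N (λ _ → + 1)
  P' = partitionSum (suc N) (λ _ → + 1)
  cancel : ∀ x y → (x ℤ.+ y) ℤ.- y ≡ x
  cancel = solve-∀

recipₚ-qqInf : recipₚ qqInf ≗ partitionCount
recipₚ-qqInf = recipₚ-unique qqInf partitionCount refl λ n → begin
  (qqInf *ₚ partitionCount) n
    ≡⟨ sumTo-cong n (λ k k≤n → cong₂ ℤ._*_ (sym (qqUpTo-stable n k≤n))
         (sym (partitionSum-stable n (λ _ → + 1) (m∸n≤m n k)))) ⟩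
  (qqUpTo n *ₚ partitionSum n (λ _ → + 1)) n ≡⟨ qqUpTo-inverse n n ⟩
  1ₚ n ∎
  where open ≡-Reasoning

-- Frobenius symbols and hook removal

-- A column of `b` dots put to the left of the Ferrers graph; rows past the end of `μ` become 1. It
-- is meant for `length μ ≤ b`, as a longer `μ` is cut off.
pad : ℕ → List ℕ → List ℕ
pad zero    _       = []
pad (suc b) []      = 1 ∷ pad b []
pad (suc b) (x ∷ μ) = suc x ∷ pad b μ

-- Bordering μ with a hook with arm a and leg b.
glue : ℕ → ℕ → List ℕ → List ℕ
glue a b μ = suc a ∷ pad b μ

length-pad : ∀ b μ → length (pad b μ) ≡ b
length-pad zero    μ       = refl
length-pad (suc b) []      = cong suc (length-pad b [])
length-pad (suc b) (x ∷ μ) = cong suc (length-pad b μ)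

part-pad : ∀ b μ {j} → j < b → part (pad b μ) (suc j) ≡ suc (part μ (suc j))
part-pad (suc b) []      {zero}  p       = refl
part-pad (suc b) (x ∷ μ) {zero}  p       = refl
part-pad (suc b) []      {suc j} (s≤s p) = part-pad b [] p
part-pad (suc b) (x ∷ μ) {suc j} (s≤s p) = part-pad b μ p

conjPart-pad-1 : ∀ b μ → conjPart (pad b μ) 1 ≡ b
conjPart-pad-1 zero    μ       = refl
conjPart-pad-1 (suc b) []      = cong suc (conjPart-pad-1 b [])
conjPart-pad-1 (suc b) (x ∷ μ) = cong suc (conjPart-pad-1 b μ)

conjPart-pad : ∀ b μ j → length μ ≤ b → conjPart (pad b μ) (suc (suc j)) ≡ conjPart μ (suc j)
conjPart-pad zero    []      j _ = refl
conjPart-pad (suc b) []      j _ = conjPart-pad b [] j z≤n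
conjPart-pad (suc b) (x ∷ μ) j (s≤s p) with j <ᵇ x
... | true  = cong suc (conjPart-pad b μ j p)
... | false = conjPart-pad b μ j p

countBelow : (ℕ → Bool) → ℕ → ℕ
countBelow p zero    = 0
countBelow p (suc n) = if p 0 then suc (countBelow (p ∘ suc) n) else countBelow (p ∘ suc) n

length-filter-applyUpTo : ∀ (p : ℕ → Bool) h n →
  length (filter (λ i → T? (p i)) (applyUpTo h n)) ≡ countBelow (p ∘ h) n
length-filter-applyUpTo p h zero    = refl
length-filter-applyUpTo p h (suc n) with p (h 0)
... | true  = cong suc (length-filter-applyUpTo p (h ∘ suc) n)
... | false = length-filter-applyUpTo p (h ∘ suc) n

countBelow-≤ : ∀ p n → countBelow p n ≤ n
countBelow-≤ p zero = z≤n
countBelow-≤ p (suc n) with p 0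
... | true  = s≤s (countBelow-≤ (p ∘ suc) n)
... | false = m≤n⇒m≤1+n (countBelow-≤ (p ∘ suc) n)

countBelow-bound : ∀ p n a → (∀ j → p j ≡ true → j < a) → countBelow p n ≤ a
countBelow-bound p zero    a _ = z≤n
countBelow-bound p (suc n) a h with p 0 in eq
... | false = countBelow-bound (p ∘ suc) n a (λ j pj → <⇒≤ (h (suc j) pj))
countBelow-bound p (suc n) zero    h | true with () ← h 0 eq
countBelow-bound p (suc n) (suc a) h | true = s≤s (countBelow-bound (p ∘ suc) n a (λ j pj → s≤s⁻¹ (h (suc j) pj)))

-- The tests depend on the row number so that the induction can drop the first row and renumber.
-- Rows that `pad` adds below `μ` hold a 0 on the right-hand side and are not counted.
countBelow-pad : ∀ (r r' : ℕ → ℕ → Bool) → (∀ j x → r j (suc x) ≡ r' j x) → (∀ j → r' j 0 ≡ false) →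
  ∀ b μ → length μ ≤ b →
  countBelow (λ j → r j (part (pad b μ) (suc j))) b ≡ countBelow (λ j → r' j (part μ (suc j))) (length μ)
countBelow-pad r r' p z zero    []      _ = refl
countBelow-pad r r' p z (suc b) []      _ rewrite p 0 0 | z 0 =
  countBelow-pad (r ∘ suc) (r' ∘ suc) (p ∘ suc) (z ∘ suc) b [] z≤n
countBelow-pad r r' p z (suc b) (x ∷ μ) (s≤s l) rewrite p 0 x with r' 0 x
... | true  = cong suc (countBelow-pad (r ∘ suc) (r' ∘ suc) (p ∘ suc) (z ∘ suc) b μ l)
... | false = countBelow-pad (r ∘ suc) (r' ∘ suc) (p ∘ suc) (z ∘ suc) b μ l

diagonal≡countBelow : ∀ μ → diagonal μ ≡ countBelow (λ j → j <ᵇ part μ (suc j)) (length μ)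
diagonal≡countBelow μ = length-filter-applyUpTo (λ i → i ≤ᵇ part μ i) suc (length μ)

diagonal-glue : ∀ a b μ → length μ ≤ b → diagonal (glue a b μ) ≡ suc (diagonal μ)
diagonal-glue a b μ l = begin
  diagonal (glue a b μ)  ≡⟨ diagonal≡countBelow (glue a b μ) ⟩
  suc (countBelow (λ j → suc j <ᵇ part (pad b μ) (suc j)) (length (pad b μ)))
    ≡⟨ cong (suc ∘ countBelow _) (length-pad b μ) ⟩
  suc (countBelow (λ j → suc j <ᵇ part (pad b μ) (suc j)) b)
    ≡⟨ cong suc (countBelow-pad (λ j x → suc j <ᵇ x) _<ᵇ_ (λ _ _ → refl) (λ _ → refl) b μ l) ⟩
  suc (countBelow (λ j → j <ᵇ part μ (suc j)) (length μ)) ≡⟨ cong suc (diagonal≡countBelow μ) ⟨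
  suc (diagonal μ)       ∎
  where open ≡-Reasoning

part-≤ : ∀ {a μ} → All (_≤ a) μ → ∀ j → part μ (suc j) ≤ a
part-≤ []       j       = z≤n
part-≤ (p ∷ ps) zero    = p
part-≤ (p ∷ ps) (suc j) = part-≤ ps j

diagonal-≤-part : ∀ a μ → All (_≤ a) μ → diagonal μ ≤ a
diagonal-≤-part a μ ps rewrite diagonal≡countBelow μ =
  countBelow-bound _ (length μ) a (λ j eq → ≤-trans (<ᵇ⇒< j _ (subst T (sym eq) _)) (part-≤ ps j))

diagonal-≤-length : ∀ μ → diagonal μ ≤ length μ
diagonal-≤-length μ rewrite diagonal≡countBelow μ = countBelow-≤ _ (length μ)

applyUpTo-cong : ∀ {A : Set} {f g : ℕ → A} n → (∀ j → j < n → f j ≡ g j) → applyUpTo f n ≡ applyUpTo g n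
applyUpTo-cong zero    p = refl
applyUpTo-cong (suc n) p = cong₂ _∷_ (p 0 (s≤s z≤n)) (applyUpTo-cong n (λ j j<n → p (suc j) (s≤s j<n)))

<⇒<ᵇ≡true : ∀ {m n} → m < n → (m <ᵇ n) ≡ true
<⇒<ᵇ≡true {zero}  (s≤s p) = refl
<⇒<ᵇ≡true {suc m} (s≤s p) = <⇒<ᵇ≡true p

≤⇒<ᵇ≡false : ∀ {m n} → n ≤ m → (m <ᵇ n) ≡ false
≤⇒<ᵇ≡false {m}     z≤n     = refl
≤⇒<ᵇ≡false {suc m} (s≤s p) = ≤⇒<ᵇ≡false p

-- Past the hook, row lengths, column lengths and positions all grow by one, so arms and legs are
-- unchanged. The bounds on `μ` keep its diagonal within both the leg and the arm of the hook.
frobenius-glue : ∀ a b μ → length μ ≤ b → All (_≤ a) μ → frobenius (glue a b μ) ≡ col a b ∷ frobenius μ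
frobenius-glue a b μ l ps = begin
  map F (range1 (diagonal (glue a b μ)))       ≡⟨ cong (map F ∘ range1) (diagonal-glue a b μ l) ⟩
  F 1 ∷ map F (applyUpTo (suc ∘ suc) (diagonal μ))
    ≡⟨ cong₂ _∷_ (cong (col a) (conjPart-pad-1 b μ)) (map-applyUpTo (suc ∘ suc) F (diagonal μ)) ⟩
  col a b ∷ applyUpTo (F ∘ suc ∘ suc) (diagonal μ)
    ≡⟨ cong (col a b ∷_) (applyUpTo-cong (diagonal μ) column) ⟩
  col a b ∷ applyUpTo (G ∘ suc) (diagonal μ)   ≡⟨ cong (col a b ∷_) (map-applyUpTo suc G (diagonal μ)) ⟨
  col a b ∷ frobenius μ                        ∎
  where
  open ≡-Reasoning
  F = λ i → col (part (glue a b μ) i ∸ i) (conjPart (glue a b μ) i ∸ i)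
  G = λ i → col (part μ i ∸ i) (conjPart μ i ∸ i)
  conjPart-glue : ∀ j → j < a → conjPart (glue a b μ) (suc (suc j)) ≡ suc (conjPart μ (suc j))
  conjPart-glue j j<a rewrite <⇒<ᵇ≡true j<a = cong suc (conjPart-pad b μ j l)
  column : ∀ j → j < diagonal μ → F (suc (suc j)) ≡ G (suc j)
  column j j<d = cong₂ col
    (cong (_∸ suc (suc j)) (part-pad b μ (≤-trans j<d (≤-trans (diagonal-≤-length μ) l))))
    (cong (_∸ suc (suc j)) (conjPart-glue j (≤-trans j<d (diagonal-≤-part a μ ps))))

signs : List ℕ → List Bool
signs μ = map positive (frobenius μ)

signs-glue : ∀ a b μ → length μ ≤ b → All (_≤ a) μ → signs (glue a b μ) ≡ (b <ᵇ a) ∷ signs μ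
signs-glue a b μ l ps = cong (map positive) (frobenius-glue a b μ l ps)

-- `partitionsAux` bounds only the largest part, so the bound on the number of parts is carried by
-- the weight.
atMost exactly : ℕ → Weight → Weight
atMost  b Q μ = if length μ <ᵇ suc b then Q μ else + 0
exactly b Q μ = if length μ ≡ᵇ b then Q μ else + 0

split-< : ∀ l b (x : ℤ) →
  (if l <ᵇ suc b then x else + 0) ≡ (if l <ᵇ b then x else + 0) ℤ.+ (if l ≡ᵇ b then x else + 0)
split-< zero    zero    x = sym (ℤ.+-identityˡ x)
split-< zero    (suc b) x = sym (ℤ.+-identityʳ x)
split-< (suc l) zero    x = refl
split-< (suc l) (suc b) x = split-< l b x

-- Removing the first column of the Ferrers graph from partitions with exactly b parts.
partitionSum-exactly : ∀ k b Q →
  partitionSum (suc k) (exactly b Q) ≗ shift b (partitionSum k (atMost b (Q ∘ pad b)))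
partitionSum-exactly zero zero Q n = begin
  partitionSum 1 (exactly 0 Q) n   ≡⟨ partitionSum-suc 0 (exactly 0 Q) n ⟩
  partitionSum 0 (exactly 0 Q) n ℤ.+ shift 1 (partitionSum 1 (λ _ → + 0)) n
    ≡⟨ cong₂ ℤ._+_ (trans (partitionSum-zero (exactly 0 Q) n) (sym (partitionSum-zero (atMost 0 (Q ∘ pad 0)) n)))
         (trans (shift-cong 1 (partitionSum-0 1) n) (shift-0 1 n)) ⟩
  partitionSum 0 (atMost 0 (Q ∘ pad 0)) n ℤ.+ + 0  ≡⟨ ℤ.+-identityʳ _ ⟩
  partitionSum 0 (atMost 0 (Q ∘ pad 0)) n          ∎
  where open ≡-Reasoning
partitionSum-exactly zero (suc b) Q n = begin
  partitionSum 1 (exactly (suc b) Q) n   ≡⟨ partitionSum-suc 0 (exactly (suc b) Q) n ⟩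
  partitionSum 0 (exactly (suc b) Q) n ℤ.+ shift 1 (partitionSum 1 (exactly b (Q ∘ (1 ∷_)))) n
    ≡⟨ cong₂ ℤ._+_ (trans (partitionSum-zero (exactly (suc b) Q) n) (constₚ-0 n))
         (shift-cong 1 (partitionSum-exactly 0 b (Q ∘ (1 ∷_))) n) ⟩
  + 0 ℤ.+ shift 1 (shift b (partitionSum 0 (atMost b (Q ∘ (1 ∷_) ∘ pad b)))) n
    ≡⟨ trans (ℤ.+-identityˡ _) (shift-shift 1 b _ n) ⟩
  shift (suc b) (partitionSum 0 (atMost b (Q ∘ (1 ∷_) ∘ pad b))) n
    ≡⟨ shift-cong (suc b) (λ i → trans (partitionSum-zero (atMost b (Q ∘ (1 ∷_) ∘ pad b)) i)
         (sym (partitionSum-zero (atMost (suc b) (Q ∘ pad (suc b))) i))) n ⟩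
  shift (suc b) (partitionSum 0 (atMost (suc b) (Q ∘ pad (suc b)))) n ∎
  where
  open ≡-Reasoning
partitionSum-exactly (suc k) zero Q n = begin
  partitionSum (2 + k) (exactly 0 Q) n   ≡⟨ partitionSum-suc (suc k) (exactly 0 Q) n ⟩
  partitionSum (suc k) (exactly 0 Q) n ℤ.+ shift (2 + k) (partitionSum (2 + k) (λ _ → + 0)) n
    ≡⟨ cong₂ ℤ._+_ (partitionSum-exactly k 0 Q n)
         (trans (shift-cong (2 + k) (partitionSum-0 (2 + k)) n) (shift-0 (2 + k) n)) ⟩
  partitionSum k (atMost 0 (Q ∘ pad 0)) n ℤ.+ + 0
    ≡⟨ cong (ℤ._+_ (partitionSum k (atMost 0 (Q ∘ pad 0)) n))
         (trans (shift-cong (suc k) (partitionSum-0 (suc k)) n) (shift-0 (suc k) n)) ⟨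
  partitionSum k (atMost 0 (Q ∘ pad 0)) n ℤ.+ shift (suc k) (partitionSum (suc k) (λ _ → + 0)) n
    ≡⟨ partitionSum-suc k (atMost 0 (Q ∘ pad 0)) n ⟨
  partitionSum (suc k) (atMost 0 (Q ∘ pad 0)) n ∎
  where open ≡-Reasoning
partitionSum-exactly (suc k) (suc b) Q n = begin
  partitionSum (2 + k) (exactly (suc b) Q) n   ≡⟨ partitionSum-suc (suc k) (exactly (suc b) Q) n ⟩
  partitionSum (suc k) (exactly (suc b) Q) n ℤ.+ shift (2 + k) (partitionSum (2 + k) (exactly b (Q ∘ (2 + k ∷_)))) n
    ≡⟨ cong₂ ℤ._+_ (partitionSum-exactly k (suc b) Q n)
         (trans (shift-cong (2 + k) (partitionSum-exactly (suc k) b (Q ∘ (2 + k ∷_))) n)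
                (trans (shift-shift (2 + k) b R n)
                       (trans (cong (λ e → shift e R n) exponent) (sym (shift-shift (suc b) (suc k) R n))))) ⟩
  shift (suc b) (partitionSum k S) n ℤ.+ shift (suc b) (shift (suc k) R) n
    ≡⟨ shift-+ (suc b) (partitionSum k S) (shift (suc k) R) n ⟨
  shift (suc b) (λ i → partitionSum k S i ℤ.+ shift (suc k) R i) n
    ≡⟨ shift-cong (suc b) (λ i → sym (partitionSum-suc k S i)) n ⟩
  shift (suc b) (partitionSum (suc k) S) n ∎
  where
  open ≡-Reasoning
  R = partitionSum (suc k) (atMost b (Q ∘ (2 + k ∷_) ∘ pad b))
  S = atMost (suc b) (Q ∘ pad (suc b))
  -- A part `2 + k` and then a column of `b` contain as many dots as a column of `suc b` and then a
  -- part `suc k`.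
  exponent : 2 + k + b ≡ suc b + suc k
  exponent = cong suc (trans (cong suc (+-comm k b)) (sym (+-suc b k)))

boxSum : ℕ → ℕ → Weight → PS
boxSum a b Q = partitionSum a (atMost b Q)

-- Inclusion-exclusion: what lies in neither smaller box has largest part `suc a` and `suc b` parts,
-- so its outer hook has `a + b + 1` dots and its removal leaves an arbitrary partition in the `a`
-- by `b` box.
boxSum-suc : ∀ a b Q n → boxSum (suc a) (suc b) Q n ℤ.+ boxSum a b Q n ≡
  (boxSum a (suc b) Q n ℤ.+ boxSum (suc a) b Q n) ℤ.+ shift (suc (a + b)) (boxSum a b (Q ∘ glue a b)) n
boxSum-suc a b Q n = begin
  boxSum (suc a) (suc b) Q n ℤ.+ B
    ≡⟨ cong (ℤ._+ B) (partitionSum-suc a (atMost (suc b) Q) n) ⟩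
  (A ℤ.+ shift (suc a) (partitionSum (suc a) (atMost b Q')) n) ℤ.+ B
    ≡⟨ cong (λ x → (A ℤ.+ x) ℤ.+ B) (shift-cong (suc a) (partitionSum-≗ (suc a) (λ μ → split-< (length μ) b (Q' μ))) n) ⟩
  (A ℤ.+ shift (suc a) (partitionSum (suc a) (λ μ → atMost b Q (suc a ∷ μ) ℤ.+ exactly b Q' μ)) n) ℤ.+ B
    ≡⟨ cong (λ x → (A ℤ.+ x) ℤ.+ B)
         (trans (shift-cong (suc a) (partitionSum-+ (suc a) (atMost b Q ∘ (suc a ∷_)) (exactly b Q')) n)
                (shift-+ (suc a) _ _ n)) ⟩
  (A ℤ.+ (C ℤ.+ shift (suc a) (partitionSum (suc a) (exactly b Q')) n)) ℤ.+ B
    ≡⟨ cong (λ x → (A ℤ.+ (C ℤ.+ x)) ℤ.+ B)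
         (trans (shift-cong (suc a) (partitionSum-exactly a b Q') n) (shift-shift (suc a) b _ n)) ⟩
  (A ℤ.+ (C ℤ.+ D)) ℤ.+ B    ≡⟨ rearrange A B C D ⟩
  (A ℤ.+ (B ℤ.+ C)) ℤ.+ D    ≡⟨ cong (λ x → (A ℤ.+ x) ℤ.+ D) (partitionSum-suc a (atMost b Q) n) ⟨
  (A ℤ.+ boxSum (suc a) b Q n) ℤ.+ D ∎
  where
  open ≡-Reasoning
  Q' = Q ∘ (suc a ∷_)
  A = boxSum a (suc b) Q n
  B = boxSum a b Q n
  C = shift (suc a) (partitionSum (suc a) (atMost b Q ∘ (suc a ∷_))) n
  D = shift (suc (a + b)) (boxSum a b (Q ∘ glue a b)) n
  rearrange : ∀ x y z w → (x ℤ.+ (z ℤ.+ w)) ℤ.+ y ≡ (x ℤ.+ (y ℤ.+ z)) ℤ.+ w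
  rearrange = solve-∀

boxSum-zeroˡ : ∀ b Q n → boxSum 0 b Q n ≡ constₚ (Q []) n
boxSum-zeroˡ b Q n = partitionSum-zero (atMost b Q) n

boxSum-zeroʳ : ∀ a Q n → boxSum a 0 Q n ≡ constₚ (Q []) n
boxSum-zeroʳ zero    Q n = boxSum-zeroˡ 0 Q n
boxSum-zeroʳ (suc a) Q n = begin
  boxSum (suc a) 0 Q n   ≡⟨ partitionSum-suc a (atMost 0 Q) n ⟩
  boxSum a 0 Q n ℤ.+ shift (suc a) (partitionSum (suc a) (λ _ → + 0)) n
    ≡⟨ cong₂ ℤ._+_ (boxSum-zeroʳ a Q n)
         (trans (shift-cong (suc a) (partitionSum-0 (suc a)) n) (shift-0 (suc a) n)) ⟩
  constₚ (Q []) n ℤ.+ + 0 ≡⟨ ℤ.+-identityʳ _ ⟩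
  constₚ (Q []) n ∎
  where open ≡-Reasoning

boxSum-cong : ∀ a b {Q Q' : Weight} n → (∀ μ → length μ ≤ b → All (_≤ a) μ → Q μ ≡ Q' μ) →
  boxSum a b Q n ≡ boxSum a b Q' n
boxSum-cong a b {Q} {Q'} n p = partitionSum-cong a n (λ μ _ ps → agree μ ps)
  where
  agree : ∀ μ → All (_≤ a) μ → atMost b Q μ ≡ atMost b Q' μ
  agree μ ps with length μ <ᵇ suc b in eq
  ... | true  = p μ (s≤s⁻¹ (<ᵇ⇒< (length μ) (suc b) (subst T (sym eq) _))) ps
  ... | false = refl

boxSum-large : ∀ a b Q {n} → n ≤ a → n ≤ b → boxSum a b Q n ≡ partitionSum n Q n
boxSum-large a b Q {n} n≤a n≤b = trans (partitionSum-stable a (atMost b Q) n≤a)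
  (partitionSum-cong n n (λ μ len _ →
    cong (λ c → if c then Q μ else + 0) (<⇒<ᵇ≡true (s≤s (≤-trans len n≤b)))))

-- Gaussian binomials

qbin : ℕ → ℕ → PS
qbin zero    zero    i = 1ₚ i
qbin zero    (suc k) i = + 0
qbin (suc n) zero    i = 1ₚ i
qbin (suc n) (suc k) i = qbin n k i ℤ.+ shift (suc k) (qbin n (suc k)) i

qbin-< : ∀ {n k} → n < k → ∀ i → qbin n k i ≡ + 0
qbin-< {zero}  {suc k} _       i = refl
qbin-< {suc n} {suc k} (s≤s p) i =
  cong₂ ℤ._+_ (qbin-< p i) (trans (shift-cong (suc k) (qbin-< (m≤n⇒m≤1+n p)) i) (shift-0 (suc k) i))

qbin-zero : ∀ n → qbin n 0 ≗ 1ₚ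
qbin-zero zero    i = refl
qbin-zero (suc n) i = refl

qbin-diagonal : ∀ n → qbin n n ≗ 1ₚ
qbin-diagonal zero    i = refl
qbin-diagonal (suc n) i = begin
  qbin n n i ℤ.+ shift (suc n) (qbin n (suc n)) i
    ≡⟨ cong₂ ℤ._+_ (qbin-diagonal n i) (trans (shift-cong (suc n) (qbin-< {n} {suc n} ≤-refl) i) (shift-0 (suc n) i)) ⟩
  1ₚ i ℤ.+ + 0 ≡⟨ ℤ.+-identityʳ _ ⟩
  1ₚ i         ∎
  where open ≡-Reasoning

shift-+-cong : ∀ e {f g h k} → (∀ i → f i ℤ.+ g i ≡ h i ℤ.+ k i) →
  ∀ i → shift e f i ℤ.+ shift e g i ≡ shift e h i ℤ.+ shift e k i
shift-+-cong e {f} {g} {h} {k} p i =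
  trans (sym (shift-+ e f g i)) (trans (shift-cong e p i) (shift-+ e h k i))

shift-qbin-suc : ∀ e n k i →
  shift e (qbin (suc n) (suc k)) i ≡ shift e (qbin n k) i ℤ.+ shift (e + suc k) (qbin n (suc k)) i
shift-qbin-suc e n k i = trans (shift-+ e (qbin n k) _ i)
  (cong (ℤ._+_ (shift e (qbin n k) i)) (shift-shift e (suc k) (qbin n (suc k)) i))

-- Linear combination of equations: each use adds a multiple of a known equation, and what remains
-- is an identity for the ring solver.
add-equation : ∀ {l r : ℤ} → l ≡ r → ∀ {x y} → x ≡ y ℤ.+ (l ℤ.- r) → x ≡ y
add-equation {l} refl {y = y} p = trans p (cancel y l)
  where
  cancel : ∀ y u → y ℤ.+ (u ℤ.- u) ≡ y
  cancel = solve-∀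

-- (1 − q^(k+1)) [n+1, k+1] = (1 − q^(n+1)) [n, k], with both sides moved so that no subtraction occurs;
-- likewise (q^k − q^(n+1)) [n+1, k] = q^k (1 − q^(n+1)) [n, k] below.
qbin-absorb : ∀ n k i → qbin (suc n) (suc k) i ℤ.+ shift (suc n) (qbin n k) i ≡
                        qbin n k i ℤ.+ shift (suc k) (qbin (suc n) (suc k)) i
qbin-absorb′ : ∀ n k i → shift k (qbin (suc n) k) i ℤ.+ shift (k + suc n) (qbin n k) i ≡
                         shift (suc n) (qbin (suc n) k) i ℤ.+ shift k (qbin n k) i

qbin-absorb zero    zero    i = cong₂ ℤ._+_ (qbin-diagonal 1 i) (shift-cong 1 (λ j → sym (qbin-diagonal 1 j)) i)
qbin-absorb zero    (suc k) i = cong₂ ℤ._+_ (qbin-< {1} {suc (suc k)} (s≤s (s≤s z≤n)) i)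
  (trans (shift-0 1 i) (sym (trans (shift-cong (2 + k) (qbin-< {1} {suc (suc k)} (s≤s (s≤s z≤n))) i) (shift-0 (2 + k) i))))
qbin-absorb (suc m) k i = begin
  (qbin n k i ℤ.+ shift (suc k) (qbin n (suc k)) i) ℤ.+ shift (suc n) (qbin n k) i
    ≡⟨ add-equation h₁ (add-equation (sym (shifted i))
         (combine (qbin n k i) (shift (suc k) (qbin n (suc k)) i) (shift (suc n) (qbin n k) i)
           (shift (suc k) (qbin n k) i) (shift (suc k + suc k) (qbin n (suc k)) i)
           (shift (suc k) (qbin m k) i) (shift (suc k + n) (qbin m k) i))) ⟩
  qbin n k i ℤ.+ (shift (suc k) (qbin n k) i ℤ.+ shift (suc k + suc k) (qbin n (suc k)) i)
    ≡⟨ cong (ℤ._+_ (qbin n k i)) (shift-qbin-suc (suc k) n k i) ⟨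
  qbin n k i ℤ.+ shift (suc k) (qbin (suc n) (suc k)) i ∎
  where
  open ≡-Reasoning
  n = suc m
  h₁ : shift (suc k) (qbin n (suc k)) i ℤ.+ shift (suc k + n) (qbin m k) i ≡
       shift (suc k) (qbin m k) i ℤ.+ shift (suc k + suc k) (qbin n (suc k)) i
  h₁ = trans (cong (ℤ._+_ (shift (suc k) (qbin n (suc k)) i)) (sym (shift-shift (suc k) n (qbin m k) i)))
      (trans (shift-+-cong (suc k) (qbin-absorb m k) i)
             (cong (ℤ._+_ (shift (suc k) (qbin m k) i)) (shift-shift (suc k) (suc k) (qbin n (suc k)) i)))
  -- This is `qbin-absorb′ m k` times `q`, which is why coefficient 0 is trivial.
  shifted : ∀ i → shift (suc k) (qbin n k) i ℤ.+ shift (suc k + n) (qbin m k) i ≡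
                        shift (suc n) (qbin n k) i ℤ.+ shift (suc k) (qbin m k) i
  shifted zero    = refl
  shifted (suc i) = qbin-absorb′ m k i
  combine : ∀ g a b c d e f → (g ℤ.+ a) ℤ.+ b ≡
    ((g ℤ.+ (c ℤ.+ d)) ℤ.+ ((a ℤ.+ f) ℤ.- (e ℤ.+ d))) ℤ.+ ((b ℤ.+ e) ℤ.- (c ℤ.+ f))
  combine = solve-∀

qbin-absorb′ m zero    i = trans (cong (λ x → 1ₚ i ℤ.+ x) (shift-cong (suc m) (qbin-zero m) i))
  (trans (ℤ.+-comm (1ₚ i) _) (cong (ℤ._+_ (shift (suc m) 1ₚ i)) (sym (qbin-zero m i))))
qbin-absorb′ m (suc j) i = begin
  shift k (qbin n k) i ℤ.+ z                        ≡⟨ add-equation (sym (qbin-absorb m j i)) (combine (qbin m j i) (shift k (qbin n k) i) (shift k (qbin m k) i) y z) ⟩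
  (y ℤ.+ z) ℤ.+ shift k (qbin m k) i
    ≡⟨ cong (ℤ._+ shift k (qbin m k) i) (sym (trans (shift-qbin-suc n m j i) (cong (λ e → y ℤ.+ shift e (qbin m k) i) (+-comm n k)))) ⟩
  shift n (qbin n k) i ℤ.+ shift k (qbin m k) i     ∎
  where
  open ≡-Reasoning
  n = suc m
  k = suc j
  y = shift n (qbin m j) i
  z = shift (k + n) (qbin m k) i
  combine : ∀ a u w y z → u ℤ.+ z ≡ ((y ℤ.+ z) ℤ.+ w) ℤ.+ ((a ℤ.+ u) ℤ.- ((a ℤ.+ w) ℤ.+ y))
  combine = solve-∀

shift-shift-≡ : ∀ a b {c} f → a + b ≡ c → shift a (shift b f) ≗ shift c f
shift-shift-≡ a b f refl = shift-shift a b f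

-- The Pascal rule [n+1, k+1] = [n, k+1] + q^(n−k) [n, k], multiplied by q^k.
qbin-pascal : ∀ n k i → shift k (qbin (suc n) (suc k)) i ≡
  shift k (qbin n (suc k)) i ℤ.+ shift n (qbin n k) i
qbin-pascal zero    zero    i = trans (ℤ.+-comm (1ₚ i) _) (cong (ℤ._+ 1ₚ i) (shift-0 1 i))
qbin-pascal zero    (suc k) i = trans
  (shift-cong (suc k) (qbin-< {1} {suc (suc k)} (s≤s (s≤s z≤n))) i)
  (sym (ℤ.+-identityʳ _))
qbin-pascal (suc m) k i = begin
  shift k (qbin (suc n) (suc k)) i      ≡⟨ shift-qbin-suc k n k i ⟩
  -- The two Pascal rules agree because `(1 - q^(k+1)) [n, k+1]` and `(1 - q^(n-k)) [n, k]` both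
  -- equal `(1 - q^n) [n-1, k]`; everything is multiplied by `q^k`.
  c ℤ.+ d                               ≡⟨ add-equation h (add-equation (qbin-absorb′ m k i) (combine a b c d e f)) ⟩
  a ℤ.+ b                               ∎
  where
  open ≡-Reasoning
  n = suc m
  a = shift k (qbin n (suc k)) i
  b = shift n (qbin n k) i
  c = shift k (qbin n k) i
  d = shift (k + suc k) (qbin n (suc k)) i
  e = shift (k + n) (qbin m k) i
  f = shift k (qbin m k) i
  h : f ℤ.+ d ≡ a ℤ.+ e
  h = trans (cong (ℤ._+_ f) (sym (shift-shift k (suc k) _ i)))
     (trans (sym (shift-+-cong k (qbin-absorb m k) i)) (cong (ℤ._+_ a) (shift-shift k n _ i)))
  combine : ∀ a b c d e f → c ℤ.+ d ≡
    ((a ℤ.+ b) ℤ.+ ((f ℤ.+ d) ℤ.- (a ℤ.+ e))) ℤ.+ ((c ℤ.+ e) ℤ.- (b ℤ.+ f))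
  combine = solve-∀

-- The condition on `s` makes `q^s q^(n-k)` equal to `q^k`, so no difference of exponents is left.
-- Multiplying by `q^n` reduces it to `qbin-pascal`, and that power is then cancelled.
qbin-pascal-shifted : ∀ s n k → n + s ≡ k + k → ∀ i →
  shift s (qbin (suc n) (suc k)) i ≡ shift s (qbin n (suc k)) i ℤ.+ shift k (qbin n k) i
qbin-pascal-shifted s n k n+s≡2k = shift-cancel n λ i → begin
  shift n (shift s (qbin (suc n) (suc k))) i
    ≡⟨ trans (shift-shift-≡ n s _ n+s≡2k i) (sym (shift-shift k k _ i)) ⟩
  shift k (shift k (qbin (suc n) (suc k))) i
    ≡⟨ trans (shift-cong k (qbin-pascal n k) i) (shift-+ k _ _ i) ⟩
  shift k (shift k (qbin n (suc k))) i ℤ.+ shift k (shift n (qbin n k)) i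
    ≡⟨ cong₂ ℤ._+_ (trans (shift-shift-≡ k k _ (sym n+s≡2k) i) (sym (shift-shift n s _ i)))
                   (shift-comm k n (qbin n k) i) ⟩
  shift n (shift s (qbin n (suc k))) i ℤ.+ shift n (shift k (qbin n k)) i
    ≡⟨ shift-+ n _ _ i ⟨
  shift n (λ i → shift s (qbin n (suc k)) i ℤ.+ shift k (qbin n k) i) i ∎
  where open ≡-Reasoning

-- The counterpart of `boxSum-suc` with `n = a + b`. The exponent `suc n` does not involve `k`, so
-- the lower index may be displaced from `a` to `a + h`.
qbin-interior : ∀ n k i → qbin (2 + n) (suc k) i ℤ.+ qbin n k i ≡
  (qbin (suc n) k i ℤ.+ qbin (suc n) (suc k) i) ℤ.+ shift (suc n) (qbin n k) i
qbin-interior n k i = add-equation (sym (qbin-absorb n k i))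
  (combine (qbin (suc n) k i) (shift (suc k) (qbin (suc n) (suc k)) i) (qbin n k i)
           (qbin (suc n) (suc k) i) (shift (suc n) (qbin n k) i))
  where
  combine : ∀ a b c d e → (a ℤ.+ b) ℤ.+ c ≡ ((a ℤ.+ d) ℤ.+ e) ℤ.+ ((c ℤ.+ b) ℤ.- (d ℤ.+ e))
  combine = solve-∀

-- The reflection of the altSum formulas at the line bounding their region of validity.
qbin-boundary : ∀ e s n k → n + s ≡ suc k + suc k → ∀ i →
  shift (e + s) (qbin (suc n) (2 + k)) i ℤ.+ shift e (qbin n k) i ≡
  shift (e + s) (qbin n (2 + k)) i ℤ.+ shift e (qbin (suc n) (suc k)) i
qbin-boundary e s n k n+s≡ i = begin
  shift (e + s) (qbin (suc n) (2 + k)) i ℤ.+ x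
    ≡⟨ cong (ℤ._+ x) (sym (shift-shift e s _ i)) ⟩
  shift e (shift s (qbin (suc n) (2 + k))) i ℤ.+ x
    ≡⟨ cong (ℤ._+ x) (trans (shift-cong e (qbin-pascal-shifted s n (suc k) n+s≡) i) (shift-+ e _ _ i)) ⟩
  (shift e (shift s (qbin n (2 + k))) i ℤ.+ shift e (shift (suc k) (qbin n (suc k))) i) ℤ.+ x
    ≡⟨ combine (shift e (shift s (qbin n (2 + k))) i) (shift e (shift (suc k) (qbin n (suc k))) i) x ⟩
  shift e (shift s (qbin n (2 + k))) i ℤ.+ (x ℤ.+ shift e (shift (suc k) (qbin n (suc k))) i)
    ≡⟨ cong₂ ℤ._+_ (shift-shift e s _ i) (sym (shift-+ e _ _ i)) ⟩
  shift (e + s) (qbin n (2 + k)) i ℤ.+ shift e (qbin (suc n) (suc k)) i ∎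
  where
  open ≡-Reasoning
  x = shift e (qbin n k) i
  combine : ∀ a b c → (a ℤ.+ b) ℤ.+ c ≡ a ℤ.+ (c ℤ.+ b)
  combine a b c = trans (ℤ.+-assoc a b c) (cong (ℤ._+_ a) (ℤ.+-comm b c))

-- Alternating subsequences of signs

-- Whether the list has an alternating subsequence of length m starting with f.
alternates : Bool → ℕ → List Bool → Bool
alternates f     zero    σ           = true
alternates f     (suc m) []          = false
alternates true  (suc m) (true  ∷ σ) = alternates false m σ
alternates true  (suc m) (false ∷ σ) = alternates true (suc m) σ
alternates false (suc m) (true  ∷ σ) = alternates false (suc m) σ
alternates false (suc m) (false ∷ σ) = alternates true m σ

alternating : Bool → ℕ → Weight
alternating f m μ = indicator (alternates f m (signs μ))

altSum : Bool → ℕ → ℕ → ℕ → PS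
altSum f m a b = boxSum a b (alternating f m)

altSum-suc : ∀ f m a b s → (b <ᵇ a) ≡ s → ∀ n →
  altSum f m (suc a) (suc b) n ℤ.+ altSum f m a b n ≡
  (altSum f m a (suc b) n ℤ.+ altSum f m (suc a) b n) ℤ.+
  shift (suc (a + b)) (boxSum a b (λ μ → indicator (alternates f m (s ∷ signs μ)))) n
altSum-suc f m a b s refl n = trans (boxSum-suc a b (alternating f m) n)
  (cong (ℤ._+_ (altSum f m a (suc b) n ℤ.+ altSum f m (suc a) b n))
    (shift-cong (suc (a + b)) (λ i → boxSum-cong a b i
      (λ μ l ps → cong (indicator ∘ alternates f m) (signs-glue a b μ l ps))) n))

-- A positive hook cannot supply a first letter `false`, and the empty word asks for none, so the
-- word passes it by. Splitting on `m` lets `alternates` compute.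
altSum-skip-true : ∀ m a b → b < a → ∀ n →
  altSum false m (suc a) (suc b) n ℤ.+ altSum false m a b n ≡
  (altSum false m a (suc b) n ℤ.+ altSum false m (suc a) b n) ℤ.+ shift (suc (a + b)) (altSum false m a b) n
altSum-skip-true zero    a b b<a = altSum-suc false zero a b true (<⇒<ᵇ≡true b<a)
altSum-skip-true (suc m) a b b<a = altSum-suc false (suc m) a b true (<⇒<ᵇ≡true b<a)

altSum-skip-false : ∀ m a b → a ≤ b → ∀ n →
  altSum true m (suc a) (suc b) n ℤ.+ altSum true m a b n ≡
  (altSum true m a (suc b) n ℤ.+ altSum true m (suc a) b n) ℤ.+ shift (suc (a + b)) (altSum true m a b) n
altSum-skip-false zero    a b a≤b = altSum-suc true zero a b false (≤⇒<ᵇ≡false a≤b)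
altSum-skip-false (suc m) a b a≤b = altSum-suc true (suc m) a b false (≤⇒<ᵇ≡false a≤b)

-- Columns (x , b) with x < a ≤ b + 1 are negative, so they consume the first letter false.
altSum-tie-false : ∀ m a b → a ≤ suc b → ∀ n →
  altSum false (suc m) a (suc b) n ℤ.+ altSum true m a b n ≡
  altSum false (suc m) a b n ℤ.+ altSum true m a (suc b) n
altSum-tie-false m zero    b _         n = cong₂ ℤ._+_
  (trans (boxSum-zeroˡ (suc b) (alternating false (suc m)) n) (sym (boxSum-zeroˡ b (alternating false (suc m)) n)))
  (trans (boxSum-zeroˡ b (alternating true m) n) (sym (boxSum-zeroˡ (suc b) (alternating true m) n)))
altSum-tie-false m (suc a) b (s≤s a≤b) n =
  -- The hook consumes the letter in `W` and is skipped in `V`, so both have the same hook term and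
  -- it drops out of `W - V`. The change of `W - V` in `b` is therefore the same for every `a`, and
  -- it is 0 at `a = 0`.
  add-equation (altSum-suc false (suc m) a b false (≤⇒<ᵇ≡false a≤b) n)
  (add-equation (sym (altSum-skip-false m a b a≤b n))
  (add-equation (altSum-tie-false m a b (m≤n⇒m≤1+n a≤b) n)
  (combine (W (suc a) (suc b)) (W (suc a) b) (W a (suc b)) (W a b)
           (V (suc a) (suc b)) (V (suc a) b) (V a (suc b)) (V a b)
           (shift (suc (a + b)) (altSum true m a b) n))))
  where
  W V : ℕ → ℕ → ℤ
  W a b = altSum false (suc m) a b n
  V a b = altSum true m a b n
  combine : ∀ w₁₁ w₁₀ w₀₁ w₀₀ v₁₁ v₁₀ v₀₁ v₀₀ x → w₁₁ ℤ.+ v₁₀ ≡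
    (((w₁₀ ℤ.+ v₁₁) ℤ.+ ((w₁₁ ℤ.+ w₀₀) ℤ.- ((w₀₁ ℤ.+ w₁₀) ℤ.+ x)))
      ℤ.+ (((v₀₁ ℤ.+ v₁₀) ℤ.+ x) ℤ.- (v₁₁ ℤ.+ v₀₀)))
      ℤ.+ ((w₀₁ ℤ.+ v₀₀) ℤ.- (w₀₀ ℤ.+ v₀₁))
  combine = solve-∀

-- Columns (a , y) with y < b ≤ a are positive, so they consume the first letter true.
altSum-tie-true : ∀ m a b → b ≤ a → ∀ n →
  altSum true (suc m) (suc a) b n ℤ.+ altSum false m a b n ≡
  altSum true (suc m) a b n ℤ.+ altSum false m (suc a) b n
altSum-tie-true m a zero    _   n = cong₂ ℤ._+_
  (trans (boxSum-zeroʳ (suc a) (alternating true (suc m)) n) (sym (boxSum-zeroʳ a (alternating true (suc m)) n)))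
  (trans (boxSum-zeroʳ a (alternating false m) n) (sym (boxSum-zeroʳ (suc a) (alternating false m) n)))
altSum-tie-true m a (suc b) b<a n =
  add-equation (altSum-suc true (suc m) a b true (<⇒<ᵇ≡true b<a) n)
  (add-equation (sym (altSum-skip-true m a b b<a n))
  (add-equation (altSum-tie-true m a b (<⇒≤ b<a) n)
  (combine (W (suc a) (suc b)) (W (suc a) b) (W a (suc b)) (W a b)
           (V (suc a) (suc b)) (V (suc a) b) (V a (suc b)) (V a b)
           (shift (suc (a + b)) (altSum false m a b) n))))
  where
  W V : ℕ → ℕ → ℤ
  W a b = altSum true (suc m) a b n
  V a b = altSum false m a b n
  combine : ∀ w₁₁ w₁₀ w₀₁ w₀₀ v₁₁ v₁₀ v₀₁ v₀₀ x → w₁₁ ℤ.+ v₀₁ ≡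
    (((w₀₁ ℤ.+ v₁₁) ℤ.+ ((w₁₁ ℤ.+ w₀₀) ℤ.- ((w₀₁ ℤ.+ w₁₀) ℤ.+ x)))
      ℤ.+ (((v₀₁ ℤ.+ v₁₀) ℤ.+ x) ℤ.- (v₁₁ ℤ.+ v₀₀)))
      ℤ.+ ((w₁₀ ℤ.+ v₀₀) ℤ.- (w₀₀ ℤ.+ v₁₀))
  combine = solve-∀

-- The number of partitions of n whose signs satisfy alternates f m is p(n − energy f m);
-- displacement f m is the shift of the lower index of the Gaussian binomial produced by m reflections.
displacement energy : Bool → ℕ → ℕ
displacement f     zero    = 0
displacement true  (suc m) = 2 + displacement false m
displacement false (suc m) = 1 + displacement true m
energy f     zero    = 0
energy true  (suc m) = energy false m + (2 + 2 * displacement false m)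
energy false (suc m) = energy true m + (1 + 2 * displacement true m)

-- Displaced Gaussian binomials as solutions of the box recurrence

shift-qbin-interior : ∀ e a b h i →
  shift e (qbin (suc a + suc b) (suc a + h)) i ℤ.+ shift e (qbin (a + b) (a + h)) i ≡
  (shift e (qbin (a + suc b) (a + h)) i ℤ.+ shift e (qbin (suc a + b) (suc a + h)) i)
    ℤ.+ shift (suc (a + b)) (shift e (qbin (a + b) (a + h))) i
shift-qbin-interior e a b h i rewrite +-suc a b = begin
  shift e (qbin (2 + n) (suc k)) i ℤ.+ shift e (qbin n k) i
    ≡⟨ shift-+-cong e (qbin-interior n k) i ⟩
  shift e (λ j → qbin (suc n) k j ℤ.+ qbin (suc n) (suc k) j) i ℤ.+ shift e (shift (suc n) (qbin n k)) i
    ≡⟨ cong₂ ℤ._+_ (shift-+ e _ _ i) (shift-comm e (suc n) (qbin n k) i) ⟩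
  (shift e (qbin (suc n) k) i ℤ.+ shift e (qbin (suc n) (suc k)) i) ℤ.+ shift (suc n) (shift e (qbin n k)) i ∎
  where
  open ≡-Reasoning
  n = a + b
  k = a + h

cancel-summand : ∀ {x y u v : ℤ} → x ℤ.+ u ≡ y ℤ.+ v → u ≡ v → x ≡ y
cancel-summand {x} {y} {u} p refl = add-equation p (rearrange x y u)
  where
  rearrange : ∀ x y u → x ≡ y ℤ.+ ((x ℤ.+ u) ℤ.- (y ℤ.+ u))
  rearrange = solve-∀

SkipsHook : Bool → ℕ → ℕ → ℕ → Set
SkipsHook f m a b = ∀ n → altSum f m (suc a) (suc b) n ℤ.+ altSum f m a b n ≡
  (altSum f m a (suc b) n ℤ.+ altSum f m (suc a) b n) ℤ.+ shift (suc (a + b)) (altSum f m a b) n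

module _ (f : Bool) (m e h : ℕ) where

  -- By symmetry of Gaussian binomials the two forms differ in the sign of `h`; having both keeps
  -- `h` a natural number. For `h > 0` the first vanishes at `b = 0` and the second at `a = 0`, the
  -- axis on which the respective region begins.
  FormulaByArm FormulaByLeg : ℕ → ℕ → Set
  FormulaByArm a b = altSum f m a b ≗ shift e (qbin (a + b) (a + h))
  FormulaByLeg a b = altSum f m a b ≗ shift e (qbin (b + a) (b + h))

  formulaByArm-suc : ∀ a b → SkipsHook f m a b →
    FormulaByArm a (suc b) → FormulaByArm (suc a) b → FormulaByArm a b → FormulaByArm (suc a) (suc b)
  formulaByArm-suc a b skips p₀₁ p₁₀ p₀₀ n = cancel-summand
    (trans (skips n)
      (trans (cong₂ ℤ._+_ (cong₂ ℤ._+_ (p₀₁ n) (p₁₀ n)) (shift-cong (suc (a + b)) p₀₀ n))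
             (sym (shift-qbin-interior e a b h n))))
    (p₀₀ n)

  formulaByLeg-suc : ∀ a b → SkipsHook f m a b →
    FormulaByLeg a (suc b) → FormulaByLeg (suc a) b → FormulaByLeg a b → FormulaByLeg (suc a) (suc b)
  formulaByLeg-suc a b skips p₀₁ p₁₀ p₀₀ n = cancel-summand
    (trans (skips n)
      (trans (cong₂ ℤ._+_ (trans (ℤ.+-comm _ (altSum f m (suc a) b n)) (cong₂ ℤ._+_ (p₁₀ n) (p₀₁ n)))
               (trans (shift-cong (suc (a + b)) p₀₀ n)
                      (cong (λ c → shift (suc c) (shift e (qbin (b + a) (b + h))) n) (+-comm a b))))
             (sym (shift-qbin-interior e b a h n))))
    (p₀₀ n)

altSum-vanishes : ∀ f m e a b {n k} → n < k → altSum f (suc m) a b ≗ constₚ (+ 0) →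
  altSum f (suc m) a b ≗ shift e (qbin n k)
altSum-vanishes f m e a b {n} {k} n<k p i = begin
  altSum f (suc m) a b i     ≡⟨ p i ⟩
  constₚ (+ 0) i             ≡⟨ constₚ-0 i ⟩
  + 0                        ≡⟨ shift-0 e i ⟨
  shift e (λ _ → + 0) i      ≡⟨ shift-cong e (λ j → sym (qbin-< n<k j)) i ⟩
  shift e (qbin n k) i       ∎
  where open ≡-Reasoning

boxCount-arm : ∀ f a b → FormulaByArm f 0 0 0 a b
boxCount-arm f zero    b       n = trans (boxSum-zeroˡ b (alternating f 0) n) (sym (qbin-zero b n))
boxCount-arm f (suc a) zero    n = trans (boxSum-zeroʳ (suc a) (alternating f 0) n)
  (sym (qbin-diagonal (suc (a + 0)) n))
boxCount-arm f (suc a) (suc b)   = formulaByArm-suc f 0 0 0 a b (altSum-suc f 0 a b (b <ᵇ a) refl)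
  (boxCount-arm f a (suc b)) (boxCount-arm f (suc a) b) (boxCount-arm f a b)

boxCount-leg : ∀ f a b → FormulaByLeg f 0 0 0 a b
boxCount-leg f a       zero    n = trans (boxSum-zeroʳ a (alternating f 0) n) (sym (qbin-zero a n))
boxCount-leg f zero    (suc b) n = trans (boxSum-zeroˡ (suc b) (alternating f 0) n)
  (sym (qbin-diagonal (suc (b + 0)) n))
boxCount-leg f (suc a) (suc b)   = formulaByLeg-suc f 0 0 0 a b (altSum-suc f 0 a b (b <ᵇ a) refl)
  (boxCount-leg f a (suc b)) (boxCount-leg f (suc a) b) (boxCount-leg f a b)

ByArm ByLeg : Bool → ℕ → ℕ → ℕ → Set
ByArm f m = FormulaByArm f m (energy f m) (displacement f m)
ByLeg f m = FormulaByLeg f m (energy f m) (displacement f m)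

-- The recurrence would need the box `a` by `suc a`, outside the region, and its hook would consume
-- the letter. The tie gives the value instead, from the box with one row less and from the shorter
-- word, whose region reaches across the diagonal.
altSum-false-diagonal : ∀ m a b → b ≡ a → ByLeg true m (suc a) b → ByLeg true m (suc a) (suc b) →
  ByArm false (suc m) (suc a) b → ByArm false (suc m) (suc a) (suc b)
altSum-false-diagonal m a .a refl p₁₀ p₁₁ q₁₀ n = cancel-summand
  (begin
    altSum false (suc m) (suc a) (suc a) n ℤ.+ altSum true m (suc a) a n
      ≡⟨ altSum-tie-false m (suc a) a ≤-refl n ⟩
    altSum false (suc m) (suc a) a n ℤ.+ altSum true m (suc a) (suc a) n
      ≡⟨ cong₂ ℤ._+_ (q₁₀ n) (p₁₁ n) ⟩
    shift (e + s) (qbin (suc a + a) (suc a + suc h)) n ℤ.+ shift e (qbin (suc a + suc a) (suc a + h)) n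
      ≡⟨ cong (ℤ._+ shift e (qbin (suc a + suc a) (suc a + h)) n)
           (cong₂ (λ x y → shift (e + s) (qbin x y) n) (sym (+-suc a a)) (cong suc (+-suc a h))) ⟩
    shift (e + s) (qbin (a + suc a) (2 + (a + h))) n ℤ.+ shift e (qbin (suc a + suc a) (suc a + h)) n
      ≡⟨ qbin-boundary e s (a + suc a) (a + h) (exponents a h) n ⟨
    shift (e + s) (qbin (suc a + suc a) (2 + (a + h))) n ℤ.+ shift e (qbin (a + suc a) (a + h)) n
      ≡⟨ cong (λ y → shift (e + s) (qbin (suc a + suc a) (suc y)) n ℤ.+ shift e (qbin (a + suc a) (a + h)) n) (sym (+-suc a h)) ⟩
    shift (e + s) (qbin (suc a + suc a) (suc a + suc h)) n ℤ.+ shift e (qbin (a + suc a) (a + h)) n ∎)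
  (p₁₀ n)
  where
  open ≡-Reasoning
  e = energy true m
  h = displacement true m
  -- The solution of the condition in `qbin-boundary` for `n = 2a + 1` and `k = a + h`; that it is
  -- free of `a` makes one `energy` work along the whole diagonal.
  s = 1 + 2 * h
  exponents : ∀ a h → (a + suc a) + (1 + 2 * h) ≡ suc (a + h) + suc (a + h)
  exponents = ℕ-Solver.solve-∀

altSum-false-suc : ∀ m → (∀ a b → a ≤ suc b → ByLeg true m a b) → ∀ a b → b ≤ a → ByArm false (suc m) a b
altSum-false-suc m p a       zero    b≤a = altSum-vanishes false m (energy false (suc m)) a 0
  (+-monoʳ-< a {0} {displacement false (suc m)} (s≤s z≤n)) (boxSum-zeroʳ a (alternating false (suc m)))
altSum-false-suc m p (suc a) (suc b) (s≤s b≤a) with m≤n⇒m<n∨m≡n b≤a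
... | inj₁ b<a = formulaByArm-suc false (suc m) (energy false (suc m)) (displacement false (suc m)) a b
  (altSum-skip-true (suc m) a b b<a) (altSum-false-suc m p a (suc b) b<a)
  (altSum-false-suc m p (suc a) b (m≤n⇒m≤1+n b≤a)) (altSum-false-suc m p a b b≤a)
... | inj₂ b≡a = altSum-false-diagonal m a b b≡a
  (p (suc a) b (s≤s (≤-reflexive (sym b≡a))))
  (p (suc a) (suc b) (s≤s (m≤n⇒m≤1+n (≤-reflexive (sym b≡a)))))
  (altSum-false-suc m p (suc a) b (m≤n⇒m≤1+n b≤a))

-- Equal arm and leg count as negative, so here the boundary consists of the boxes `suc a` by `a`,
-- and the tie steps in the direction of the arm.
altSum-true-diagonal : ∀ m a b → a ≡ b → ByArm false m a b → ByArm false m (suc a) b →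
  ByLeg true (suc m) a b → ByLeg true (suc m) (suc a) b
altSum-true-diagonal m a .a refl p₀₀ p₁₀ q₀₀ n = cancel-summand
  (begin
    altSum true (suc m) (suc a) a n ℤ.+ altSum false m a a n
      ≡⟨ altSum-tie-true m a a ≤-refl n ⟩
    altSum true (suc m) a a n ℤ.+ altSum false m (suc a) a n
      ≡⟨ cong₂ ℤ._+_ (q₀₀ n) (p₁₀ n) ⟩
    shift (e + s) (qbin (a + a) (a + (2 + h))) n ℤ.+ shift e (qbin (suc a + a) (suc a + h)) n
      ≡⟨ cong (λ y → shift (e + s) (qbin (a + a) y) n ℤ.+ shift e (qbin (suc a + a) (suc a + h)) n) (index a h) ⟩
    shift (e + s) (qbin (a + a) (2 + (a + h))) n ℤ.+ shift e (qbin (suc a + a) (suc a + h)) n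
      ≡⟨ qbin-boundary e s (a + a) (a + h) (exponents a h) n ⟨
    shift (e + s) (qbin (suc a + a) (2 + (a + h))) n ℤ.+ shift e (qbin (a + a) (a + h)) n
      ≡⟨ cong₂ (λ x y → shift (e + s) (qbin x y) n ℤ.+ shift e (qbin (a + a) (a + h)) n)
           (sym (+-suc a a)) (sym (index a h)) ⟩
    shift (e + s) (qbin (a + suc a) (a + (2 + h))) n ℤ.+ shift e (qbin (a + a) (a + h)) n ∎)
  (p₀₀ n)
  where
  open ≡-Reasoning
  e = energy false m
  h = displacement false m
  -- Here `n = 2a`, one less than for the letter `false`, so the exponent is one more.
  s = 2 + 2 * h
  index : ∀ a h → a + (2 + h) ≡ 2 + (a + h)
  index = ℕ-Solver.solve-∀
  exponents : ∀ a h → (a + a) + (2 + 2 * h) ≡ suc (a + h) + suc (a + h)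
  exponents = ℕ-Solver.solve-∀

altSum-true-suc : ∀ m → (∀ a b → b ≤ a → ByArm false m a b) → ∀ a b → a ≤ suc b → ByLeg true (suc m) a b
altSum-true-suc m p zero    b a≤1+b = altSum-vanishes true m (energy true (suc m)) 0 b
  (+-monoʳ-< b {0} {displacement true (suc m)} (s≤s z≤n))
  (boxSum-zeroˡ b (alternating true (suc m)))
-- The region contains a single box with `b = 0` off the axis, 1 by 0, and it lies on the boundary.
altSum-true-suc m p (suc a) zero    (s≤s z≤n) = altSum-true-diagonal m 0 0 refl
  (p 0 0 z≤n) (p 1 0 z≤n) (altSum-true-suc m p 0 0 z≤n)
altSum-true-suc m p (suc a) (suc b) (s≤s a≤1+b) with m≤n⇒m<n∨m≡n a≤1+b
... | inj₁ (s≤s a≤b) = formulaByLeg-suc true (suc m) (energy true (suc m)) (displacement true (suc m)) a b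
  (altSum-skip-false (suc m) a b a≤b) (altSum-true-suc m p a (suc b) (m≤n⇒m≤1+n a≤1+b))
  (altSum-true-suc m p (suc a) b (s≤s a≤b)) (altSum-true-suc m p a b a≤1+b)
... | inj₂ a≡1+b = altSum-true-diagonal m a (suc b) a≡1+b
  (p a (suc b) (≤-reflexive (sym a≡1+b))) (p (suc a) (suc b) (m≤n⇒m≤1+n (≤-reflexive (sym a≡1+b))))
  (altSum-true-suc m p a (suc b) (m≤n⇒m≤1+n a≤1+b))

altSum-false : ∀ m a b → b ≤ a → ByArm false m a b
altSum-true  : ∀ m a b → a ≤ suc b → ByLeg true m a b
altSum-false zero    a b _ = boxCount-arm false a b
altSum-false (suc m)       = altSum-false-suc m (altSum-true m)
altSum-true  zero    a b _ = boxCount-leg true a b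
altSum-true  (suc m)       = altSum-true-suc m (altSum-false m)

-- `boxCount-arm` read backwards makes `[B+k, B]` the count for a `B` by `k` box, and up to size `n`
-- every partition fits into it.
shift-partitionCount : ∀ e {n A B} k → B + k ≡ A → n ≤ k → n ≤ B →
  shift e (qbin A B) n ≡ shift e partitionCount n
shift-partitionCount e {n} {A} {B} k refl n≤k n≤B = shift-cong-≤ e n (λ {j} j≤n → begin
  qbin (B + k) B j             ≡⟨ cong (λ c → qbin (B + k) c j) (sym (+-identityʳ B)) ⟩
  qbin (B + k) (B + 0) j       ≡⟨ boxCount-arm true B k j ⟨
  boxSum B k (λ _ → + 1) j     ≡⟨ boxSum-large B k (λ _ → + 1) (≤-trans j≤n n≤B) (≤-trans j≤n n≤k) ⟩
  partitionCount j             ∎)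
  where open ≡-Reasoning

n+h+h+n : ∀ n h → (n + h + h) + n ≡ (n + h) + (n + h)
n+h+h+n = ℕ-Solver.solve-∀

alternating-count : ∀ f m n → partitionSum n (alternating f m) n ≡ shift (energy f m) partitionCount n
alternating-count true m n = begin
  partitionSum n (alternating true m) n     ≡⟨ boxSum-large N N (alternating true m) (m≤m+n n h) (m≤m+n n h) ⟨
  altSum true m N N n                       ≡⟨ altSum-true m N N (n≤1+n N) n ⟩
  shift (energy true m) (qbin (N + N) (N + h)) n
    ≡⟨ shift-partitionCount (energy true m) n (n+h+h+n n h) ≤-refl (≤-trans (m≤m+n n h) (m≤m+n N h)) ⟩
  shift (energy true m) partitionCount n    ∎
  where
  open ≡-Reasoning
  h = displacement true m
  -- The displaced coefficient belongs to a box with sides `N + h` and `N - h`; the shorter one must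
  -- still be `n`.
  N = n + h
alternating-count false m n = begin
  partitionSum n (alternating false m) n    ≡⟨ boxSum-large N N (alternating false m) (m≤m+n n h) (m≤m+n n h) ⟨
  altSum false m N N n                      ≡⟨ altSum-false m N N ≤-refl n ⟩
  shift (energy false m) (qbin (N + N) (N + h)) n
    ≡⟨ shift-partitionCount (energy false m) n (n+h+h+n n h) ≤-refl (≤-trans (m≤m+n n h) (m≤m+n N h)) ⟩
  shift (energy false m) partitionCount n   ∎
  where
  open ≡-Reasoning
  h = displacement false m
  N = n + h

-- Parity blocks

-- The indicator of the sign lists with exactly m blocks, the first of sign f.
exactBlocks : Bool → ℕ → List Bool → ℤ
exactBlocks f     zero    []          = + 1
exactBlocks f     zero    (_ ∷ _)     = + 0
exactBlocks f     (suc m) []          = + 0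
exactBlocks true  (suc m) (true  ∷ σ) = exactBlocks true (suc m) σ ℤ.+ exactBlocks false m σ
exactBlocks true  (suc m) (false ∷ σ) = + 0
exactBlocks false (suc m) (true  ∷ σ) = + 0
exactBlocks false (suc m) (false ∷ σ) = exactBlocks false (suc m) σ ℤ.+ exactBlocks true m σ

exactBlocks-not : ∀ f m σ → exactBlocks (not f) m (f ∷ σ) ≡ + 0
exactBlocks-not f     zero    σ = refl
exactBlocks-not true  (suc m) σ = refl
exactBlocks-not false (suc m) σ = refl

-- One sign per block is the best choice, so the longest alternating subsequence starting with `f`
-- has a letter for each block, except for a first block of sign `not f`. Its length being exactly
-- `m` thus splits into the two cases on the right.
alternates-exactBlocks : ∀ f m σ → indicator (alternates f m σ) ≡
  indicator (alternates f (suc m) σ) ℤ.+ (exactBlocks f m σ ℤ.+ exactBlocks (not f) (suc m) σ)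
alternates-exactBlocks f     zero    []          = refl
alternates-exactBlocks f     (suc m) []          = refl
alternates-exactBlocks true  zero    (true  ∷ σ) = refl
alternates-exactBlocks false zero    (false ∷ σ) = refl
alternates-exactBlocks true  (suc m) (true  ∷ σ) = trans (alternates-exactBlocks false m σ)
  (cong (ℤ._+_ (indicator (alternates false (suc m) σ)))
    (trans (ℤ.+-comm (exactBlocks false m σ) _) (sym (ℤ.+-identityʳ _))))
alternates-exactBlocks false (suc m) (false ∷ σ) = trans (alternates-exactBlocks true m σ)
  (cong (ℤ._+_ (indicator (alternates true (suc m) σ)))
    (trans (ℤ.+-comm (exactBlocks true m σ) _) (sym (ℤ.+-identityʳ _))))
alternates-exactBlocks true  zero    (false ∷ σ) = trans (alternates-exactBlocks true 0 σ)
  (cong (ℤ._+_ (indicator (alternates true 1 σ)))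
    (trans (ℤ.+-comm (exactBlocks true 0 σ) _) (sym (ℤ.+-identityˡ _))))
alternates-exactBlocks true  (suc m) (false ∷ σ) = trans (alternates-exactBlocks true (suc m) σ)
  (cong (ℤ._+_ (indicator (alternates true (2 + m) σ)))
    (trans (ℤ.+-comm (exactBlocks true (suc m) σ) _) (sym (ℤ.+-identityˡ _))))
alternates-exactBlocks false zero    (true  ∷ σ) = trans (alternates-exactBlocks false 0 σ)
  (cong (ℤ._+_ (indicator (alternates false 1 σ)))
    (trans (ℤ.+-comm (exactBlocks false 0 σ) _) (sym (ℤ.+-identityˡ _))))
alternates-exactBlocks false (suc m) (true  ∷ σ) = trans (alternates-exactBlocks false (suc m) σ)
  (cong (ℤ._+_ (indicator (alternates false (2 + m) σ)))
    (trans (ℤ.+-comm (exactBlocks false (suc m) σ) _) (sym (ℤ.+-identityˡ _))))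

-- The sign reached after `m` sign changes; it translates between the first and the last block.
flip : ℕ → Bool → Bool
flip zero    f = f
flip (suc m) f = not (flip m f)

flip-not : ∀ m f → flip m (not f) ≡ not (flip m f)
flip-not zero    f = refl
flip-not (suc m) f = cong not (flip-not m f)

flip-involutive : ∀ m f → flip m (flip m f) ≡ f
flip-involutive zero    f = refl
flip-involutive (suc m) f =
  trans (cong not (flip-not m (flip m f))) (trans (not-involutive _) (flip-involutive m f))

sameSign : Bool → Bool → Bool
sameSign true  s = s
sameSign false s = not s

-- The test inside `hasBlocks`, freed from its `with` so that it can be followed through an
-- induction on the signs.
endsAfter : ℕ → Bool → List Bool → Bool
endsAfter m s []       = false
endsAfter m s (b ∷ bs) = (length (b ∷ bs) ≡ᵇ m) ∧ sameSign (lastSign bs b) s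

hasBlocks≡endsAfter : ∀ m s μ → hasBlocks m s μ ≡ endsAfter m s (runs (signs μ))
hasBlocks≡endsAfter m s μ with runs (signs μ)
... | []     = refl
... | b ∷ bs with lastSign bs b | s
... | true  | true  = refl
... | true  | false = refl
... | false | true  = refl
... | false | false = refl

runs-∷ : ∀ c σ → ∃₂ λ d ds → runs (c ∷ σ) ≡ d ∷ ds
runs-∷ c     []          = c , [] , refl
runs-∷ true  (true  ∷ σ) = runs-∷ true σ
runs-∷ true  (false ∷ σ) = true , _ , refl
runs-∷ false (true  ∷ σ) = false , _ , refl
runs-∷ false (false ∷ σ) = runs-∷ false σ

endsAfter-zero : ∀ s r → endsAfter 0 s r ≡ false
endsAfter-zero s []       = refl
endsAfter-zero s (b ∷ bs) = refl

endsAfter-∷ : ∀ m s b c σ → endsAfter (suc m) s (b ∷ runs (c ∷ σ)) ≡ endsAfter m s (runs (c ∷ σ))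
endsAfter-∷ m s b c σ with d , ds , eq ← runs-∷ c σ rewrite eq = refl

-- Of `m + 1` blocks starting with `f` the last has sign `flip m f`, so fixing the last sign fixes
-- the first. A sign equal to its successor leaves the runs alone; a different one opens a new
-- block.
endsAfter-exactBlocks : ∀ f m σ → indicator (endsAfter (suc m) (flip m f) (runs σ)) ≡ exactBlocks f (suc m) σ
endsAfter-newBlock : ∀ f m b c σ →
  indicator (endsAfter (suc m) (flip m f) (b ∷ runs (c ∷ σ))) ≡ exactBlocks (not f) m (c ∷ σ)

endsAfter-newBlock f zero    b c σ =
  cong indicator (trans (endsAfter-∷ 0 f b c σ) (endsAfter-zero f (runs (c ∷ σ))))
endsAfter-newBlock f (suc m) b c σ = trans (cong indicator (endsAfter-∷ (suc m) (not (flip m f)) b c σ))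
  (trans (cong (λ s → indicator (endsAfter (suc m) s (runs (c ∷ σ)))) (sym (flip-not m f)))
         (endsAfter-exactBlocks (not f) m (c ∷ σ)))

endsAfter-exactBlocks f     m       []          = refl
endsAfter-exactBlocks true  zero    (true  ∷ []) = refl
endsAfter-exactBlocks true  zero    (false ∷ []) = refl
endsAfter-exactBlocks false zero    (true  ∷ []) = refl
endsAfter-exactBlocks false zero    (false ∷ []) = refl
endsAfter-exactBlocks true  (suc m) (true  ∷ []) = refl
endsAfter-exactBlocks true  (suc m) (false ∷ []) = refl
endsAfter-exactBlocks false (suc m) (true  ∷ []) = refl
endsAfter-exactBlocks false (suc m) (false ∷ []) = refl
endsAfter-exactBlocks true  m (true  ∷ true  ∷ σ) = trans (endsAfter-exactBlocks true m (true ∷ σ))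
  (sym (trans (cong (ℤ._+_ (exactBlocks true (suc m) (true ∷ σ))) (exactBlocks-not true m σ)) (ℤ.+-identityʳ _)))
endsAfter-exactBlocks true  m (true  ∷ false ∷ σ) =
  trans (endsAfter-newBlock true m true false σ) (sym (ℤ.+-identityˡ _))
endsAfter-exactBlocks true  m (false ∷ true  ∷ σ) = trans (endsAfter-newBlock true m false true σ) (exactBlocks-not true m σ)
endsAfter-exactBlocks true  m (false ∷ false ∷ σ) = endsAfter-exactBlocks true m (false ∷ σ)
endsAfter-exactBlocks false m (false ∷ false ∷ σ) = trans (endsAfter-exactBlocks false m (false ∷ σ))
  (sym (trans (cong (ℤ._+_ (exactBlocks false (suc m) (false ∷ σ))) (exactBlocks-not false m σ)) (ℤ.+-identityʳ _)))
endsAfter-exactBlocks false m (false ∷ true  ∷ σ) =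
  trans (endsAfter-newBlock false m false true σ) (sym (ℤ.+-identityˡ _))
endsAfter-exactBlocks false m (true  ∷ false ∷ σ) = trans (endsAfter-newBlock false m true false σ) (exactBlocks-not false m σ)
endsAfter-exactBlocks false m (true  ∷ true  ∷ σ) = endsAfter-exactBlocks false m (true ∷ σ)

hasBlocks-exactBlocks : ∀ m s μ →
  indicator (hasBlocks (suc m) s μ) ≡ exactBlocks (flip m s) (suc m) (signs μ)
hasBlocks-exactBlocks m s μ = begin
  indicator (hasBlocks (suc m) s μ)
    ≡⟨ cong indicator (hasBlocks≡endsAfter (suc m) s μ) ⟩
  indicator (endsAfter (suc m) s (runs (signs μ)))
    ≡⟨ cong (λ t → indicator (endsAfter (suc m) t (runs (signs μ)))) (flip-involutive m s) ⟨
  indicator (endsAfter (suc m) (flip m (flip m s)) (runs (signs μ)))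
    ≡⟨ endsAfter-exactBlocks (flip m s) m (signs μ) ⟩
  exactBlocks (flip m s) (suc m) (signs μ) ∎
  where open ≡-Reasoning

blockCount : Bool → ℕ → PS
blockCount f m n = partitionSum n (exactBlocks f m ∘ signs) n

-- A nonempty partition has a diagonal dot: `signs (suc j ∷ μ)` computes to a nonempty list, so its
-- weight is 0 by computation. The surviving 1 of the empty partition is the source of the constant
-- `(-1)^m`.
blockCount-zero : ∀ f n → blockCount f 0 n ≡ 1ₚ n
blockCount-zero f zero    = refl
blockCount-zero f (suc n) = trans (listSum-partitionsAux-suc (exactBlocks f 0 ∘ signs) n n (suc n))
  (trans (sumBelow-cong (suc n ⊓ suc n) (λ j _ → listSum-0 (partitionsAux n (n ∸ j) (suc j)))) (sumBelow-0 (suc n ⊓ suc n)))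
  where
  sumBelow-0 : ∀ n → sumBelow n (λ _ → + 0) ≡ + 0
  sumBelow-0 zero    = refl
  sumBelow-0 (suc n) = trans (ℤ.+-identityʳ _) (sumBelow-0 n)

gap : Bool → ℕ → PS
gap f m n = shift (energy f m) partitionCount n ℤ.- shift (energy f (suc m)) partitionCount n

blockCount-+ : ∀ f m n → blockCount f m n ℤ.+ blockCount (not f) (suc m) n ≡ gap f m n
blockCount-+ f m n = begin
  x              ≡⟨ isolate x y ⟩
  (y ℤ.+ x) ℤ.- y
    ≡⟨ cong (λ z → z ℤ.- y) total ⟨
  partitionSum n (alternating f m) n ℤ.- y
    ≡⟨ cong₂ ℤ._-_ (alternating-count f m n) (alternating-count f (suc m) n) ⟩
  gap f m n ∎
  where
  open ≡-Reasoning
  x = blockCount f m n ℤ.+ blockCount (not f) (suc m) n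
  y = partitionSum n (alternating f (suc m)) n
  isolate : ∀ x y → x ≡ (y ℤ.+ x) ℤ.- y
  isolate = solve-∀
  total : partitionSum n (alternating f m) n ≡ y ℤ.+ x
  total = trans (partitionSum-≗ n (λ μ → alternates-exactBlocks f m (signs μ)) n)
    (trans (partitionSum-+ n (alternating f (suc m)) _ n)
           (cong (ℤ._+_ y) (partitionSum-+ n (exactBlocks f m ∘ signs) (exactBlocks (not f) (suc m) ∘ signs) n)))

sgn*sgn : ∀ m → sgn m ℤ.* sgn m ≡ + 1
sgn*sgn zero    = refl
sgn*sgn (suc m) = trans (square (sgn m)) (sgn*sgn m)
  where
  square : ∀ x → (ℤ.-[1+ 0 ] ℤ.* x) ℤ.* (ℤ.-[1+ 0 ] ℤ.* x) ≡ x ℤ.* x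
  square = solve-∀

-- For `m ≥ 1`, `m` blocks starting with `flip m f` end with `not f`, whatever `m` is. Neighbouring
-- counts of this family add up to a `gap`, so the alternating sum of gaps collapses to the case of
-- no blocks.
blockCount-telescope : ∀ f m n →
  blockCount (flip m f) m n ≡ sgn m ℤ.* (1ₚ n ℤ.- sumBelow m (λ l → sgn l ℤ.* gap (flip l f) l n))
blockCount-telescope f zero    n = trans (blockCount-zero f n) (trans (sym (ℤ.+-identityʳ (1ₚ n))) (sym (ℤ.*-identityˡ _)))
blockCount-telescope f (suc m) n = add-equation (blockCount-+ (flip m f) m n)
  (add-equation (sym (blockCount-telescope f m n))
  -- The newest gap enters with the sign `sgn m` twice, hence with coefficient 1.
  (add-equation (sym (cong (λ z → z ℤ.* gap (flip m f) m n) (sgn*sgn m)))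
  (combine (blockCount (flip (suc m) f) (suc m) n) (blockCount (flip m f) m n) (sgn m) (1ₚ n)
     (sumBelow m (λ l → sgn l ℤ.* gap (flip l f) l n)) (gap (flip m f) m n))))
  where
  combine : ∀ x y s d r g → x ≡
    (((ℤ.-[1+ 0 ] ℤ.* s) ℤ.* (d ℤ.- (r ℤ.+ s ℤ.* g)) ℤ.+ ((y ℤ.+ x) ℤ.- g))
      ℤ.+ (s ℤ.* (d ℤ.- r) ℤ.- y)) ℤ.+ (+ 1 ℤ.* g ℤ.- (s ℤ.* s) ℤ.* g)
  combine = solve-∀

length-filter-hasBlocks : ∀ m s n →
  + length (filter (λ μ → T? (hasBlocks (suc m) s μ)) (partitions n)) ≡ blockCount (flip m s) (suc m) n
length-filter-hasBlocks m s n = trans (length-filter-T? (hasBlocks (suc m) s) (partitions n))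
  (partitionSum-≗ n (hasBlocks-exactBlocks m s) n)

*ₚ-monomials : ∀ f (e e' : ℕ → ℕ) m n →
  (f *ₚ (λ n → sumBelow m (λ l → sgn l ℤ.* (monoₚ (e l) n ℤ.- monoₚ (e' l) n)))) n ≡
  sumBelow m (λ l → sgn l ℤ.* (shift (e l) f n ℤ.- shift (e' l) f n))
*ₚ-monomials f e e' zero    n = sumTo-0 n (λ k → ℤ.*-zeroʳ (f k))
*ₚ-monomials f e e' (suc m) n = begin
  (f *ₚ (S +ₚ scaleₚ (sgn m) D)) n   ≡⟨ *ₚ-distribˡ-+ f S (scaleₚ (sgn m) D) n ⟩
  (f *ₚ S) n ℤ.+ (f *ₚ scaleₚ (sgn m) D) n
    ≡⟨ cong₂ ℤ._+_ (*ₚ-monomials f e e' m n) (*ₚ-scaleʳ (sgn m) f D n) ⟩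
  R ℤ.+ sgn m ℤ.* (f *ₚ D) n
    ≡⟨ cong (λ z → R ℤ.+ sgn m ℤ.* z)
         (trans (*ₚ-distribˡ-+ f (monoₚ (e m)) (-_ ∘ monoₚ (e' m)) n)
           (cong₂ ℤ._+_ (*ₚ-monoʳ (e m) f n)
             (trans (*ₚ-negʳ f (monoₚ (e' m)) n) (cong -_ (*ₚ-monoʳ (e' m) f n))))) ⟩
  R ℤ.+ sgn m ℤ.* (shift (e m) f n ℤ.- shift (e' m) f n) ∎
  where
  open ≡-Reasoning
  S D : PS
  S n = sumBelow m (λ l → sgn l ℤ.* (monoₚ (e l) n ℤ.- monoₚ (e' l) n))
  D n = monoₚ (e m) n ℤ.- monoₚ (e' m) n
  R = sumBelow m (λ l → sgn l ℤ.* (shift (e l) f n ℤ.- shift (e' l) f n))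

-- Pentagonal exponents

step : Bool → ℕ
step true  = 2
step false = 1

displacement-suc : ∀ g l → displacement (not g) (suc l) ≡ step (not g) + displacement g l
displacement-suc true  l = refl
displacement-suc false l = refl

energy-suc : ∀ g l → energy (not g) (suc l) ≡ energy g l + (step (not g) + 2 * displacement g l)
energy-suc true  l = refl
energy-suc false l = refl

-- Prepending one letter to words of lengths `l` and `l + 1` keeps the difference `d` of their
-- displacements and raises the difference of their energies by `2d`, because energy grows by twice
-- the displacement.
energy-increment : ∀ g l d i →
  displacement g (suc l) ≡ d + displacement g l → energy g (suc l) ≡ energy g l + i →
  displacement (not g) (2 + l) ≡ d + displacement (not g) (suc l) ×
  energy (not g) (2 + l) ≡ energy (not g) (suc l) + (i + 2 * d)
energy-increment g l d i p q
  rewrite displacement-suc g (suc l) | displacement-suc g l | energy-suc g (suc l) | energy-suc g l | p | q =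
  swap (step (not g)) d (displacement g l) , regroup (energy g l) i (step (not g)) d (displacement g l)
  where
  swap : ∀ s d h → s + (d + h) ≡ d + (s + h)
  swap = ℕ-Solver.solve-∀
  regroup : ∀ e i s d h → (e + i) + (s + 2 * (d + h)) ≡ (e + (s + 2 * h)) + (i + 2 * d)
  regroup = ℕ-Solver.solve-∀

-- Starting from a one-letter word with `d = i = 1` or `d = i = 2`, this yields the exponents
-- `2l + 1` and `4l + 2` of the theorem.
increments : ∀ f d i → displacement f 1 ≡ d → energy f 1 ≡ i → ∀ l →
  displacement (flip l f) (suc l) ≡ d + displacement (flip l f) l ×
  energy (flip l f) (suc l) ≡ energy (flip l f) l + (i + 2 * d * l)
increments f d i p q zero    = trans p (sym (+-identityʳ d)) , trans q (sym (trans (cong (_+_ i) (*-zeroʳ (2 * d))) (+-identityʳ i)))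
increments f d i p q (suc l) with r , s ← increments f d i p q l
  with r' , s' ← energy-increment (flip l f) l d (i + 2 * d * l) r s =
  r' , trans s' (cong (_+_ (energy (flip (suc l) f) (suc l))) (regroup i d l))
  where
  regroup : ∀ i d l → (i + 2 * d * l) + 2 * d ≡ i + 2 * d * suc l
  regroup = ℕ-Solver.solve-∀

-- Two consecutive letters displace by `1 + 2 = 3`, so the energy increments form an arithmetic
-- progression of difference 3, as those of pentagonal numbers do.
displacement-flip : ∀ f l → step (not (flip l f)) + 2 * displacement (flip l f) l ≡ 3 * l + step (not f)
displacement-flip f zero    = +-identityʳ _
displacement-flip f (suc l)
  rewrite displacement-suc (flip l f) l | not-involutive (flip l f) = begin
    step g + 2 * (step (not g) + h)                    ≡⟨ regroup (step g) (step (not g)) h ⟩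
    (step g + step (not g)) + (step (not g) + 2 * h)   ≡⟨ cong₂ _+_ (step-+ g) (displacement-flip f l) ⟩
    3 + (3 * l + step (not f))                         ≡⟨ regroup' l (step (not f)) ⟩
    3 * suc l + step (not f)                           ∎
  where
  open ≡-Reasoning
  g = flip l f
  h = displacement g l
  step-+ : ∀ g → step g + step (not g) ≡ 3
  step-+ true  = refl
  step-+ false = refl
  regroup : ∀ s t h → s + 2 * (t + h) ≡ (s + t) + (t + 2 * h)
  regroup = ℕ-Solver.solve-∀
  regroup' : ∀ l s → 3 + (3 * l + s) ≡ 3 * suc l + s
  regroup' = ℕ-Solver.solve-∀

energy-flip-suc : ∀ f l → energy (flip (suc l) f) (suc l) ≡ energy (flip l f) l + (3 * l + step (not f))
energy-flip-suc f l = trans (energy-suc (flip l f) l) (cong (_+_ (energy (flip l f) l)) (displacement-flip f l))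

energy-plus : ∀ l → l * (3 * l + 1) / 2 ≡ energy (flip l false) l
energy-plus l = trans (cong (_/ 2) (sym (double l))) (m*n/n≡m (energy (flip l false) l) 2)
  where
  double : ∀ l → energy (flip l false) l * 2 ≡ l * (3 * l + 1)
  double zero    = refl
  double (suc l) = trans (cong (_* 2) (energy-flip-suc false l))
    (trans (*-distribʳ-+ 2 (energy (flip l false) l) (3 * l + 2))
    (trans (cong (_+ (3 * l + 2) * 2) (double l)) (expand l)))
    where
    expand : ∀ l → l * (3 * l + 1) + (3 * l + 2) * 2 ≡ suc l * (3 * suc l + 1)
    expand = ℕ-Solver.solve-∀

energy-minus : ∀ l → l * (3 * l ∸ 1) / 2 ≡ energy (flip l true) l
energy-minus l = trans (cong (_/ 2) (sym (double l))) (m*n/n≡m (energy (flip l true) l) 2)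
  where
  -- Adding `l` removes the truncated subtraction and leaves a polynomial identity.
  double+ : ∀ l → energy (flip l true) l * 2 + l ≡ l * (3 * l)
  double+ zero    = refl
  double+ (suc l) = trans (cong (λ e → e * 2 + suc l) (energy-flip-suc true l))
    (trans (regroup (energy (flip l true) l) l) (trans (cong (_+ (6 * l + 3)) (double+ l)) (expand l)))
    where
    regroup : ∀ e l → (e + (3 * l + 1)) * 2 + suc l ≡ (e * 2 + l) + (6 * l + 3)
    regroup = ℕ-Solver.solve-∀
    expand : ∀ l → l * (3 * l) + (6 * l + 3) ≡ suc l * (3 * suc l)
    expand = ℕ-Solver.solve-∀
  double : ∀ l → energy (flip l true) l * 2 ≡ l * (3 * l ∸ 1)
  double zero    = refl
  double (suc l) = +-cancelʳ-≡ (suc l) _ _ (trans (double+ (suc l)) (expand l))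
    where
    -- The second factor on the right is what `3 * suc l ∸ 1` computes to.
    expand : ∀ l → suc l * (3 * suc l) ≡ suc l * (l + (suc l + (suc l + 0))) + suc l
    expand = ℕ-Solver.solve-∀

energy-plus-suc : ∀ l → l * (3 * l + 1) / 2 + (2 * l + 1) ≡ energy (flip l false) (suc l)
energy-plus-suc l = trans (cong₂ _+_ (energy-plus l) (+-comm (2 * l) 1))
  (sym (proj₂ (increments false 1 1 refl refl l)))

energy-minus-suc : ∀ l → l * (3 * l ∸ 1) / 2 + (4 * l + 2) ≡ energy (flip l true) (suc l)
energy-minus-suc l = trans (cong₂ _+_ (energy-minus l) (+-comm (4 * l) 2))
  (sym (proj₂ (increments true 2 2 refl refl l)))

-- Leaving the exponents abstract lets `sumPlus` and `sumMinus` be instances by unfolding, so both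
-- signs share one argument.
blockSeries : ∀ s (e e' : ℕ → ℕ) →
  (∀ l → e l ≡ energy (flip l (not s)) l) → (∀ l → e' l ≡ energy (flip l (not s)) (suc l)) →
  ∀ m n → + length (filter (λ μ → T? (hasBlocks (suc m) s μ)) (partitions n)) ≡
    rhs (suc m) (λ n → sumBelow (suc m) (λ l → sgn l ℤ.* (monoₚ (e l) n ℤ.- monoₚ (e' l) n))) n
blockSeries s e e' p q m n = begin
  + length (filter (λ μ → T? (hasBlocks (suc m) s μ)) (partitions n))
    ≡⟨ length-filter-hasBlocks m s n ⟩
  blockCount (flip m s) (suc m) n
    -- The first sign, found from the last sign `s`, is rewritten as a flip of `not s` to match the
    -- family that telescopes.
    ≡⟨ cong (λ f → blockCount f (suc m) n) (sym (trans (cong not (flip-not m s)) (not-involutive (flip m s)))) ⟩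
  blockCount (flip (suc m) (not s)) (suc m) n   ≡⟨ blockCount-telescope (not s) (suc m) n ⟩
  sgn (suc m) ℤ.* (1ₚ n ℤ.- G)                  ≡⟨ expand (sgn m) (1ₚ n) G ⟩
  sgn (suc m) ℤ.* 1ₚ n ℤ.+ sgn m ℤ.* G
    ≡⟨ cong₂ (λ x y → x ℤ.+ sgn m ℤ.* y) (scale-1ₚ (sgn (suc m)) n) (sym product) ⟩
  rhs (suc m) S n ∎
  where
  open ≡-Reasoning
  S : PS
  S n = sumBelow (suc m) (λ l → sgn l ℤ.* (monoₚ (e l) n ℤ.- monoₚ (e' l) n))
  G = sumBelow (suc m) (λ l → sgn l ℤ.* gap (flip l (not s)) l n)
  expand : ∀ x d g → (ℤ.-[1+ 0 ] ℤ.* x) ℤ.* (d ℤ.- g) ≡ (ℤ.-[1+ 0 ] ℤ.* x) ℤ.* d ℤ.+ x ℤ.* g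
  expand = solve-∀
  scale-1ₚ : ∀ c n → c ℤ.* 1ₚ n ≡ constₚ c n
  scale-1ₚ c zero    = ℤ.*-identityʳ c
  scale-1ₚ c (suc n) = ℤ.*-zeroʳ c
  product : (recipₚ qqInf *ₚ S) n ≡ G
  product = trans (*ₚ-congˡ S recipₚ-qqInf n) (trans (*ₚ-monomials partitionCount e e' (suc m) n)
    (sumBelow-cong (suc m) (λ l _ → cong (ℤ._*_ (sgn l))
      (cong₂ (λ x y → shift x partitionCount n ℤ.- shift y partitionCount n) (p l) (q l)))))

theorem1p2 : (m : ℕ) → 1 ≤ m →
    ((n : ℕ) → genSeries (aPlus m) n ≡ rhs m (sumPlus m) n)
    × ((n : ℕ) → genSeries (aMinus m) n ≡ rhs m (sumMinus m) n)
theorem1p2 (suc m) _ = plus , minus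
  where
  plus : ∀ n → genSeries (aPlus (suc m)) n ≡ rhs (suc m) (sumPlus (suc m)) n
  -- The empty partition has no blocks, so the count at 0 computes to the `+ 0` prescribed by
  -- `genSeries`.
  plus zero    = blockSeries true _ _ energy-plus energy-plus-suc m zero
  plus (suc n) = blockSeries true _ _ energy-plus energy-plus-suc m (suc n)
  minus : ∀ n → genSeries (aMinus (suc m)) n ≡ rhs (suc m) (sumMinus (suc m)) n
  minus zero    = blockSeries false _ _ energy-minus energy-minus-suc m zero
  minus (suc n) = blockSeries false _ _ energy-minus energy-minus-suc m (suc n)
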